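{- Let $G$ be a finite simple cubic graph, $\Pi$ a polyhedral embedding of $G$, and $G^e=G^e(\Pi)$. Suppose $G^e$ contains a butterfly two on vertices $t_0,t_{0'},t_1,t_2,t_3,t_4,t_{4'},t_5,t_{5'}$ with $[t_{0'}t_3]$ not a scaffold edge, and that the disjunction of the fork $(t_1,t_2,t_3,t_4,t_{4'})$ cannot be solved. Let $x_0,x_2,x_5$ denote the neighbours of $t_0,t_2,t_5$ respectively not lying on the cycle $(t_0t_1t_2t_3t_4t_5t_0)$. Then $G$ is isomorphic to the Franklin graph, and the scaffold multiset $\mathcal S$ of $G^e$ consists exactly of the single scaffold edges $[t_0t_5],[t_5x_5],[x_5x_0],[x_0t_0],[t_1t_2],[t_2x_2],[x_2t_{0'}],[t_{0'}t_1],[t_3t_{4'}],[t_{4'}t_{5'}],[t_{5'}t_4],[t_4t_3]$ (multiplicity one each) and the double scaffold edges $[t_0t_3],[x_0t_2],[t_1t_{4'}],[t_{0'}t_5],[t_4x_2],[x_5t_{5'}],[t_0t_{5'}],[t_1t_4],[t_2t_5],[t_3x_5],[t_{4'}x_2],[x_0t_{0'}]$ (multiplicity two each).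
   Context: An embedding of a graph in a surface without boundary is polyhedral if every facial walk is a cycle and any two distinct facial cycles intersect in either the empty set, a single vertex, or a single edge. A $\Pi$-facial subwalk is a walk formed by consecutive vertices of some $\Pi$-facial cycle (in either direction). The extended graph $G^e(\Pi)$ has vertex set $V(G)$ and edge set $E(G)$ together with a multiset $\mathcal S$ of scaffold edges: for distinct vertices $t_0,t_3$, $[t_0t_3]$ appears with multiplicity equal to the number of paths $(t_0t_1t_2t_3)$ of $G$ that are $\Pi$-facial subwalks (single if multiplicity $1$, double if $2$). A fork $(a_1,a_2,a_3,a_4,a_{4'})$ in $G^e$ consists of five distinct vertices such that $a_1a_2,a_2a_3,a_3a_4,a_3a_{4'}$ are edges of $G$ and $[a_1a_4],[a_1a_{4'}]$ are scaffold edges; its disjunction can be solved if either every polyhedral embedding $\Pi'$ of $G$ with $G^e(\Pi')=G^e$ has $(a_1a_2a_3a_4)$ as a $\Pi'$-facial subwalk, or every such $\Pi'$ has $(a_1a_2a_3a_{4'})$ as a $\Pi'$-facial subwalk; otherwise it cannot be solved. A butterfly two in $G^e$ consists of nine distinct vertices $t_0,t_{0'},t_1,t_2,t_3,t_4,t_{4'},t_5,t_{5'}$ such that $(t_0t_1t_2t_3t_4t_5t_0)$ and $(t_{0'}t_1t_2t_3t_{4'}t_{5'}t_{0'})$ are $6$-cycles of $G$ and $[t_1t_4],[t_1t_{4'}],[t_0t_3]$ are scaffold edges. -}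

module Defs where

open import Data.Nat using (ℕ; zero; suc; _≤_)
open import Data.Fin using (Fin; toℕ)
open import Data.List using (List; []; _∷_; _++_; drop; take; length; reverse)
open import Data.List.Membership.Propositional using (_∈_)
open import Data.List.Relation.Unary.Unique.Propositional using (Unique)
open import Data.Product using (Σ; ∃; ∃-syntax; _×_; _,_; proj₁; proj₂)
open import Data.Sum using (_⊎_)
open import Relation.Nullary using (¬_)
open import Relation.Binary.PropositionalEquality using (_≡_; _≢_)
open import Relation.Binary.Construct.Closure.ReflexiveTransitive using (Star)
open import Function.Bundles using (_⇔_)
open import Function.Definitions using (Bijective)

record Graph (n : ℕ) : Set₁ where
  field
    Adj    : Fin n → Fin n → Set
    sym    : ∀ {u v} → Adj u v → Adj v u
    irrefl : ∀ {u} → ¬ Adj u u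
open Graph public

Cubic : ∀ {n} → Graph n → Set
Cubic G = ∀ v → ∃[ a ] ∃[ b ] ∃[ c ]
  (Unique (a ∷ b ∷ c ∷ []) × Adj G v a × Adj G v b × Adj G v c ×
   (∀ u → Adj G v u → u ≡ a ⊎ u ≡ b ⊎ u ≡ c))

Connected : ∀ {n} → Graph n → Set
Connected G = ∀ u v → Star (Adj G) u v

rot : ∀ {A : Set} → ℕ → List A → List A
rot i xs = drop i xs ++ take i xs

ForwardSub : ∀ {n} → List (Fin n) → List (Fin n) → Set
ForwardSub c w = ∃[ i ] ∃[ rest ] (rot i c ≡ w ++ rest)

CycSub : ∀ {n} → List (Fin n) → List (Fin n) → Set
CycSub c w = ForwardSub c w ⊎ ForwardSub c (reverse w)

IsCycle : ∀ {n} → Graph n → List (Fin n) → Set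
IsCycle G c = 3 ≤ length c × Unique c ×
  (∀ u v → ForwardSub c (u ∷ v ∷ []) → Adj G u v)

IsPath4 : ∀ {n} → Graph n → Fin n → Fin n → Fin n → Fin n → Set
IsPath4 G a b c d = Unique (a ∷ b ∷ c ∷ d ∷ []) × Adj G a b × Adj G b c × Adj G c d

-- Embeddings, described by their facial walks.
-- A (cellular) embedding whose facial walks are all cycles is given by
-- the list of its facial cycles; it is an embedding of G in a closed
-- (connected) surface iff G is connected, every face is a cycle of G,
-- every edge lies on exactly two faces, and at every vertex v the faces
-- through v glue up to a disc, i.e. the "corner" relation on the
-- neighbours of v is connected.

record FaceSystem (n : ℕ) : Set where
  field
    nF   : ℕ
    face : Fin nF → List (Fin n)
open FaceSystem public

Corner : ∀ {n} → FaceSystem n → Fin n → Fin n → Fin n → Set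
Corner Π v u w = ∃[ j ] CycSub (face Π j) (u ∷ v ∷ w ∷ [])

EdgeOn : ∀ {n} → (Π : FaceSystem n) → Fin (nF Π) → Fin n → Fin n → Set
EdgeOn Π j u v = CycSub (face Π j) (u ∷ v ∷ [])

IsEmbedding : ∀ {n} → Graph n → FaceSystem n → Set
IsEmbedding G Π =
  Connected G ×
  (∀ j → IsCycle G (face Π j)) ×
  (∀ u v → Adj G u v → ∃[ i ] ∃[ j ] (i ≢ j × EdgeOn Π i u v × EdgeOn Π j u v ×
      (∀ k → EdgeOn Π k u v → k ≡ i ⊎ k ≡ j))) ×
  (∀ v u w → Adj G v u → Adj G v w → Star (Corner Π v) u w)

OnFace : ∀ {n} → (Π : FaceSystem n) → Fin (nF Π) → Fin n → Set
OnFace Π j x = x ∈ face Π j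

GoodIntersection : ∀ {n} → (Π : FaceSystem n) → Fin (nF Π) → Fin (nF Π) → Set
GoodIntersection Π i j =
  (∀ x → ¬ (OnFace Π i x × OnFace Π j x)) ⊎
  (∃[ x ] (∀ y → (OnFace Π i y × OnFace Π j y) ⇔ (y ≡ x))) ⊎
  (∃[ x ] ∃[ y ] (x ≢ y ×
     (∀ z → (OnFace Π i z × OnFace Π j z) ⇔ (z ≡ x ⊎ z ≡ y)) ×
     EdgeOn Π i x y × EdgeOn Π j x y))

IsPolyhedral : ∀ {n} → Graph n → FaceSystem n → Set
IsPolyhedral G Π = IsEmbedding G Π × (∀ i j → i ≢ j → GoodIntersection Π i j)

FacialSub : ∀ {n} → FaceSystem n → List (Fin n) → Set
FacialSub Π w = ∃[ j ] CycSub (face Π j) w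

FacialPath : ∀ {n} → Graph n → FaceSystem n → Fin n → Fin n → Fin n → Fin n → Set
FacialPath G Π a b c d = IsPath4 G a b c d × FacialSub Π (a ∷ b ∷ c ∷ d ∷ [])

Mult : ∀ {n} → Graph n → FaceSystem n → Fin n → Fin n → ℕ → Set
Mult {n} G Π a d k = Σ (List (Fin n × Fin n)) λ L →
  Unique L × length L ≡ k × (∀ p → (p ∈ L) ⇔ FacialPath G Π a (proj₁ p) (proj₂ p) d)

Scaffold : ∀ {n} → Graph n → FaceSystem n → Fin n → Fin n → Set
Scaffold G Π a d = a ≢ d × ∃[ b ] ∃[ c ] FacialPath G Π a b c d

SameExtended : ∀ {n} → Graph n → FaceSystem n → FaceSystem n → Set
SameExtended G Π Π' = ∀ u w k → u ≢ w → Mult G Π u w k ⇔ Mult G Π' u w k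

IsFork : ∀ {n} → Graph n → FaceSystem n → (a1 a2 a3 a4 a4' : Fin n) → Set
IsFork G Π a1 a2 a3 a4 a4' =
  Unique (a1 ∷ a2 ∷ a3 ∷ a4 ∷ a4' ∷ []) ×
  Adj G a1 a2 × Adj G a2 a3 × Adj G a3 a4 × Adj G a3 a4' ×
  Scaffold G Π a1 a4 × Scaffold G Π a1 a4'

ForkSolvable : ∀ {n} → Graph n → FaceSystem n → (a1 a2 a3 a4 a4' : Fin n) → Set
ForkSolvable {n} G Π a1 a2 a3 a4 a4' =
  (∀ (Π' : FaceSystem n) → IsPolyhedral G Π' → SameExtended G Π Π' →
     FacialSub Π' (a1 ∷ a2 ∷ a3 ∷ a4 ∷ [])) ⊎
  (∀ (Π' : FaceSystem n) → IsPolyhedral G Π' → SameExtended G Π Π' →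
     FacialSub Π' (a1 ∷ a2 ∷ a3 ∷ a4' ∷ []))

IsButterflyTwo : ∀ {n} → Graph n → FaceSystem n →
  (t0 t0' t1 t2 t3 t4 t4' t5 t5' : Fin n) → Set
IsButterflyTwo G Π t0 t0' t1 t2 t3 t4 t4' t5 t5' =
  Unique (t0 ∷ t0' ∷ t1 ∷ t2 ∷ t3 ∷ t4 ∷ t4' ∷ t5 ∷ t5' ∷ []) ×
  IsCycle G (t0 ∷ t1 ∷ t2 ∷ t3 ∷ t4 ∷ t5 ∷ []) ×
  IsCycle G (t0' ∷ t1 ∷ t2 ∷ t3 ∷ t4' ∷ t5' ∷ []) ×
  Scaffold G Π t1 t4 × Scaffold G Π t1 t4' × Scaffold G Π t0 t3

-- The Franklin graph: 12-cycle 0-1-...-11-0 plus chords (LCF [5,-5]^6)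

franklinEdges : List (ℕ × ℕ)
franklinEdges =
  (0 , 1) ∷ (1 , 2) ∷ (2 , 3) ∷ (3 , 4) ∷ (4 , 5) ∷ (5 , 6) ∷
  (6 , 7) ∷ (7 , 8) ∷ (8 , 9) ∷ (9 , 10) ∷ (10 , 11) ∷ (11 , 0) ∷
  (0 , 5) ∷ (1 , 8) ∷ (2 , 7) ∷ (3 , 10) ∷ (4 , 9) ∷ (6 , 11) ∷ []

FranklinAdj : Fin 12 → Fin 12 → Set
FranklinAdj i j = (toℕ i , toℕ j) ∈ franklinEdges ⊎ (toℕ j , toℕ i) ∈ franklinEdges

IsoToFranklin : ∀ {n} → Graph n → Set
IsoToFranklin {n} G = Σ (Fin n → Fin 12) λ f →
  Bijective _≡_ _≡_ f × (∀ u v → Adj G u v ⇔ FranklinAdj (f u) (f v))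

InPairs : ∀ {n} → List (Fin n × Fin n) → Fin n → Fin n → Set
InPairs ps u w = (u , w) ∈ ps ⊎ (w , u) ∈ ps

ScaffoldIs : ∀ {n} → Graph n → FaceSystem n →
  List (Fin n × Fin n) → List (Fin n × Fin n) → Set
ScaffoldIs G Π singles doubles = ∀ u w → u ≢ w →
  (InPairs singles u w → Mult G Π u w 1) ×
  (InPairs doubles u w → Mult G Π u w 2) ×
  (¬ InPairs singles u w → ¬ InPairs doubles u w → Mult G Π u w 0)

-- In a cubic graph every vertex v lies on three faces; write F v x for the one avoiding the edge
-- vx.  Along an edge bc the two faces at b through bc are the two faces at c through bc, so an
-- embedding amounts to one binary choice per edge, and a path a b c d is facial exactly when
-- F b o ≡ F c o′ for the remaining neighbours o of b and o′ of c.  Polyhedrality says that distinct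
-- vertices on two common faces are adjacent, and that F v w misses the neighbour w of v.
--
-- If the fork cannot be solved, it cannot be that no polyhedral embedding A with the given extended
-- graph has the facial walk t1 t2 t3 t4, nor that no such B has t1 t2 t3 t4'.  Comparing the scaffold
-- multiplicities of A and B while exploring the graph outwards from the butterfly leaves the
-- Franklin graph with a single embedding A, after a finite case analysis in which one splits over
-- the choice at an edge or over the identity of an unknown neighbour.  The conclusion is decidable,
-- so it follows although A and B are only known not not to exist.

module Submission where

-- The size of the graph is unknown and only nine of its vertices are given, so a neighbour met
-- later may be new or may coincide with one already seen. The case analysis therefore runs on
-- numerals that stand for vertices: a state is closed data, which the type checker can evaluate
-- while `n`, `G` and the embeddings remain variables, and an environment interprets it. The checker
-- returns proofs, so a test that is too weak can make a certificate fail but cannot make it prove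
-- anything false. At a scaffold edge, paths exhibited in one embedding are compared with the paths
-- not yet excluded in the other. Neither count has to be exact, which lets branches close while
-- most of the graph is unexplored. Only the embedding A has to be identified completely: it has the
-- multiplicities of `Π`, though it need not be `Π`.

open import Defs hiding (sym; irrefl)
open Graph using () renaming (sym to Adj-sym; irrefl to Adj-irrefl)
open import Data.Nat as ℕ using (ℕ; zero; suc; _+_; _≤_; _<_; _≤?_; _<?_; z≤n; s≤s)
import Data.Nat.Properties as ℕ
open import Data.Fin as Fin using (Fin; zero; suc; #_; toℕ; _≟_)
open import Data.Fin.Properties using (all?)
open import Data.List using (List; []; _∷_; _++_; _∷ʳ_; map; concatMap; drop; take; length;
  filter; cartesianProduct; allFin; initLast; _∷ʳ′_)
open import Data.List.Properties using (++-assoc; ++-identityʳ; ∷-injective; ∷ʳ-injective;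
  take++drop≡id; length-++; length-++-comm; length-map)
open import Data.List.Membership.Propositional using (_∈_; _∉_; find)
open import Data.List.Membership.Propositional.Properties using (∈-∃++; ∈-++⁻; ∈-++⁺ˡ; ∈-++⁺ʳ;
  ∈-insert; ∈-map⁺; ∈-map⁻; ∈-filter⁺; ∈-filter⁻; ∈-cartesianProduct⁺; ∈-allFin)
open import Data.List.Relation.Unary.Any using (Any; here; there; any?)
import Data.List.Relation.Unary.All as All
import Data.List.Relation.Unary.All.Properties as All
open import Data.List.Relation.Unary.All using (All; []; _∷_)
open import Data.List.Relation.Unary.AllPairs using ([]; _∷_)
open import Data.List.Relation.Unary.Unique.Propositional using (Unique)
open import Data.List.Relation.Unary.Unique.Propositional.Properties using (map⁺; filter⁺;
  cartesianProduct⁺; allFin⁺)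
open import Data.List.Relation.Binary.Subset.Propositional using (_⊆_)
open import Data.List.Relation.Binary.Permutation.Propositional using (↭⇒↭ₛ)
open import Data.List.Relation.Binary.Permutation.Propositional.Properties using (++-comm)
import Data.List.Relation.Binary.Permutation.Setoid.Properties as SetoidPerm
open import Data.Maybe using (Maybe; just; nothing; _>>=_; _<∣>_; to-witness-T)
open import Data.Product using (∃; ∃₂; _×_; _,_; proj₁; proj₂)
open import Data.Product.Properties using (≡-dec)
open import Data.Sum as Sum using (_⊎_; inj₁; inj₂; [_,_]′)
open import Data.Unit using (tt)
open import Data.Vec using (Vec; lookup; []; _∷_)
open import Data.Empty using (⊥-elim)
open import Function using (_∘_; _$_; id)
open import Function.Bundles using (_⇔_; mk⇔; module Equivalence)
open import Relation.Nullary using (¬_; Dec; yes; no; contradiction; ¬?)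
open import Relation.Nullary.Decidable using (dec⇒maybe; from-yes; decidable-stable; True;
  toWitness; False; toWitnessFalse; _→-dec_; _×-dec_; _⊎-dec_)
open import Relation.Binary.Construct.Closure.ReflexiveTransitive using (Star; ε; _◅_)
open import Relation.Binary.PropositionalEquality using (_≡_; _≢_; refl; sym; trans; cong; cong₂;
  subst; subst₂; setoid; ≢-sym)

-- Cyclic lists

module _ {A : Set} where

  -- Splitting `c` at `a` replaces the index of `rot`: moving the starting point by one is then a
  -- rearrangement of lists, and in a duplicate-free `c` the continuation `l` is a function of `a`.
  After : List A → A → List A → Set
  After c a l = ∃₂ λ p q → c ≡ p ++ a ∷ q × l ≡ q ++ p

  drop-length-++ : ∀ (p : List A) q → drop (length p) (p ++ q) ≡ q
  drop-length-++ [] q = refl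
  drop-length-++ (x ∷ p) q = drop-length-++ p q

  take-length-++ : ∀ (p : List A) q → take (length p) (p ++ q) ≡ p
  take-length-++ [] q = refl
  take-length-++ (x ∷ p) q = cong (x ∷_) (take-length-++ p q)

  After⇒rot : ∀ {c a l} → After c a l → ∃ λ i → rot i c ≡ a ∷ l
  After⇒rot {a = a} (p , q , refl , refl) = length p , cong₂ _++_ (drop-length-++ p (a ∷ q)) (take-length-++ p (a ∷ q))

  rot⇒After : ∀ {c a l} i → rot i c ≡ a ∷ l → After c a l
  rot⇒After {c} {a} {l} i eq = go (take i c) (drop i c) (take++drop≡id i c) eq
    where
    go : ∀ t d → t ++ d ≡ c → d ++ t ≡ a ∷ l → After c a l
    -- An index at or beyond the length leaves an empty `drop`, so the rotation is trivial and the
    -- split is at the head.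
    go t [] e refl = [] , l , trans (sym e) (++-identityʳ t) , sym (++-identityʳ l)
    go t (a ∷ q) e refl = t , q , sym e , refl

  ∉-middle : ∀ (p : List A) {a q} → Unique (p ++ a ∷ q) → a ∉ p
  ∉-middle (x ∷ p) (x∉ ∷ u) (here refl) = All.lookup x∉ (∈-insert p) refl
  ∉-middle (x ∷ p) (x∉ ∷ u) (there a∈p) = ∉-middle p u a∈p

  split-unique : ∀ (p p′ : List A) {a q q′} → Unique (p ++ a ∷ q) →
                 p ++ a ∷ q ≡ p′ ++ a ∷ q′ → p ≡ p′ × q ≡ q′
  split-unique [] [] u refl = refl , refl
  split-unique [] (x ∷ p′) (a∉ ∷ u) refl = contradiction refl (All.lookup a∉ (∈-insert p′))
  split-unique (x ∷ p) [] u refl = contradiction (here refl) (∉-middle (x ∷ p) u)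
  split-unique (x ∷ p) (x′ ∷ p′) (_ ∷ u) eq with refl , eq′ ← ∷-injective eq
    with refl , refl ← split-unique p p′ u eq′ = refl , refl

  After-functional : ∀ {c a l l′} → Unique c → After c a l → After c a l′ → l ≡ l′
  After-functional u (p , q , refl , refl) (p′ , q′ , eq , refl)
    with refl , refl ← split-unique p p′ u eq = refl

  After-step : ∀ {c a b r} → After c a (b ∷ r) → After c b (r ∷ʳ a)
  After-step {a = a} {b} {r} (p , [] , refl , refl) = [] , r ∷ʳ a , refl , sym (++-identityʳ _)
  After-step {a = a} {b} (p , b ∷ q , refl , refl) =
    p ∷ʳ a , q , sym (++-assoc p _ _) , ++-assoc q p _

  After-unstep : ∀ {c a b r} → After c b (r ∷ʳ a) → After c a (b ∷ r)
  After-unstep {a = a} {b} {r} (p , q , e , e′) with initLast p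
  ... | [] = b ∷ r , [] , trans e (cong (b ∷_) (trans (sym (++-identityʳ q)) (sym e′))) , refl
  ... | p₁ ∷ʳ′ a₁ with refl , refl ← ∷ʳ-injective r (q ++ p₁) (trans e′ (sym (++-assoc q p₁ _))) =
    p₁ , b ∷ q , trans e (++-assoc p₁ _ _) , refl

  Unique-After : ∀ {c a l} → Unique c → After c a l → Unique (a ∷ l)
  Unique-After {a = a} u (p , q , refl , refl) =
    SetoidPerm.Unique-resp-↭ (setoid A) (↭⇒↭ₛ (++-comm p (a ∷ q))) u

  length-After : ∀ {c a l} → After c a l → length c ≡ suc (length l)
  length-After {a = a} (p , q , refl , refl) = length-++-comm p (a ∷ q)

  ∈-After : ∀ {c a l} → After c a l → a ∈ c
  ∈-After (p , q , refl , _) = ∈-insert p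

Step : ∀ {n} → List (Fin n) → Fin n → Fin n → Set
Step c u v = ∃ λ r → After c u (v ∷ r)

ForwardSub⇒After : ∀ {n} {c : List (Fin n)} {a w} → ForwardSub c (a ∷ w) → ∃ λ r → After c a (w ++ r)
ForwardSub⇒After (i , r , eq) = r , rot⇒After i eq

After⇒ForwardSub : ∀ {n} {c : List (Fin n)} {a} w {r} → After c a (w ++ r) → ForwardSub c (a ∷ w)
After⇒ForwardSub w {r} h with i , eq ← After⇒rot h = i , r , eq

CycEdge : ∀ {n} → List (Fin n) → Fin n → Fin n → Set
CycEdge c u v = CycSub c (u ∷ v ∷ [])

module Cycle {n} {c : List (Fin n)} (len : 3 ≤ length c) (uniq : Unique c) where

  Step⇒CycEdge : ∀ {u v} → Step c u v → CycEdge c u v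
  Step⇒CycEdge (r , h) = inj₁ (After⇒ForwardSub (_ ∷ []) h)

  CycEdge-sym : ∀ {u v} → CycEdge c u v → CycEdge c v u
  CycEdge-sym (inj₁ h) = inj₂ h
  CycEdge-sym (inj₂ h) = inj₁ h

  CycEdge⇒Step : ∀ {u v} → CycEdge c u v → Step c u v ⊎ Step c v u
  CycEdge⇒Step (inj₁ h) = inj₁ (ForwardSub⇒After h)
  CycEdge⇒Step (inj₂ h) = inj₂ (ForwardSub⇒After h)

  Step-functional : ∀ {u v w} → Step c u v → Step c u w → v ≡ w
  Step-functional (_ , h) (_ , k) = proj₁ (∷-injective (After-functional uniq h k))

  Step-injective : ∀ {u v w} → Step c u w → Step c v w → u ≡ v
  Step-injective (r , h) (s , k) =
    proj₂ (∷ʳ-injective r s (After-functional uniq (After-step h) (After-step k)))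

  CycEdge⇒∈ : ∀ {u v} → CycEdge c u v → u ∈ c
  CycEdge⇒∈ e with CycEdge⇒Step e
  ... | inj₁ (_ , h) = ∈-After h
  ... | inj₂ (_ , h) = ∈-After (After-step h)

  -- The cycle goes on at `v` to the side away from `u`: the length bound supplies a further vertex
  -- there, and uniqueness makes it different from `u`.
  second-CycEdge : ∀ {u v} → CycEdge c u v → ∃ λ w → w ≢ u × CycEdge c v w
  second-CycEdge e with CycEdge⇒Step e
  second-CycEdge _ | inj₁ ([] , h) with s≤s (s≤s ()) ← subst (3 ≤_) (length-After h) len
  second-CycEdge _ | inj₁ (w ∷ r , h) with Unique-After uniq h
  ... | (_ ∷ u≢w ∷ _) ∷ _ = w , (λ w≡u → u≢w (sym w≡u)) , Step⇒CycEdge (_ , After-step h)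
  second-CycEdge _ | inj₂ (r , h) with initLast r
  second-CycEdge _ | inj₂ (.[] , h) | [] with s≤s (s≤s ()) ← subst (3 ≤_) (length-After h) len
  second-CycEdge {u} _ | inj₂ (_ , h) | r ∷ʳ′ w =
    w , w≢u , CycEdge-sym (Step⇒CycEdge (_ , After-unstep {r = u ∷ r} h))
    where
    w≢u : w ≢ u
    w≢u w≡u with Unique-After uniq h
    ... | _ ∷ u∉ ∷ _ = All.lookup u∉ (∈-insert r) (sym w≡u)

  -- Each vertex has one successor and one predecessor, so two of three edges at `v` run in the same
  -- direction and coincide.
  CycEdge-degree : ∀ {v x y z} → CycEdge c v x → CycEdge c v y → CycEdge c v z →
                   x ≢ y → x ≢ z → y ≡ z
  CycEdge-degree ex ey ez x≢y x≢z with CycEdge⇒Step ex | CycEdge⇒Step ey | CycEdge⇒Step ez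
  ... | inj₁ a | inj₁ b | _ = contradiction (Step-functional a b) x≢y
  ... | inj₂ a | inj₂ b | _ = contradiction (Step-injective a b) x≢y
  ... | inj₁ a | inj₂ b | inj₁ d = contradiction (Step-functional a d) x≢z
  ... | inj₁ a | inj₂ b | inj₂ d = Step-injective b d
  ... | inj₂ a | inj₁ b | inj₁ d = Step-functional b d
  ... | inj₂ a | inj₁ b | inj₂ d = contradiction (Step-injective a d) x≢z

  -- Successors are unique, so the reading from `x` is forced. Only a list of length two or three
  -- would wrap around to `x` too early, which `x ≢ z` and `x ≢ w` exclude.
  Steps⇒ForwardSub : ∀ {x y z w} → x ≢ z → x ≢ w → Step c x y → Step c y z → Step c z w →
                     ForwardSub c (x ∷ y ∷ z ∷ w ∷ [])
  Steps⇒ForwardSub x≢z x≢w (r , h) (_ , k) zw with After-functional uniq (After-step h) k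
  Steps⇒ForwardSub x≢z x≢w ([] , h) (_ , k) zw | refl = contradiction refl x≢z
  Steps⇒ForwardSub x≢z x≢w (_ ∷ r , h) (_ , k) (_ , l) | refl with After-functional uniq (After-step k) l
  Steps⇒ForwardSub x≢z x≢w (_ ∷ [] , h) (_ , k) (_ , l) | refl | refl = contradiction refl x≢w
  Steps⇒ForwardSub x≢z x≢w (_ ∷ _ ∷ r , h) (_ , k) (_ , l) | refl | refl = After⇒ForwardSub (_ ∷ _ ∷ _ ∷ []) h

  -- A change of direction between consecutive edges would give a vertex two successors or two
  -- predecessors.
  CycEdges⇒CycSub : ∀ {x y z w} → x ≢ z → x ≢ w → y ≢ w →
                    CycEdge c x y → CycEdge c y z → CycEdge c z w → CycSub c (x ∷ y ∷ z ∷ w ∷ [])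
  CycEdges⇒CycSub x≢z x≢w y≢w xy yz zw with CycEdge⇒Step xy | CycEdge⇒Step yz | CycEdge⇒Step zw
  ... | inj₁ a | inj₁ b | inj₁ d = inj₁ (Steps⇒ForwardSub x≢z x≢w a b d)
  ... | inj₂ a | inj₂ b | inj₂ d = inj₂ (Steps⇒ForwardSub (λ e → y≢w (sym e)) (λ e → x≢w (sym e)) d b a)
  ... | inj₂ a | inj₁ b | _ = contradiction (Step-functional a b) x≢z
  ... | inj₁ a | inj₂ b | _ = contradiction (Step-injective a b) x≢z
  ... | _ | inj₁ b | inj₂ d = contradiction (Step-injective b d) y≢w
  ... | _ | inj₂ b | inj₁ d = contradiction (Step-functional b d) y≢w

  ForwardSub⇒Steps : ∀ {x y z w} → ForwardSub c (x ∷ y ∷ z ∷ w ∷ []) → Step c x y × Step c y z × Step c z w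
  ForwardSub⇒Steps h with _ , k ← ForwardSub⇒After h =
    (_ , k) , (_ , After-step k) , (_ , After-step (After-step k))

  CycSub⇒CycEdges : ∀ {x y z w} → CycSub c (x ∷ y ∷ z ∷ w ∷ []) → CycEdge c x y × CycEdge c y z × CycEdge c z w
  CycSub⇒CycEdges (inj₁ h) with a , b , d ← ForwardSub⇒Steps h =
    Step⇒CycEdge a , Step⇒CycEdge b , Step⇒CycEdge d
  CycSub⇒CycEdges (inj₂ h) with a , b , d ← ForwardSub⇒Steps h =
    CycEdge-sym (Step⇒CycEdge d) , CycEdge-sym (Step⇒CycEdge b) , CycEdge-sym (Step⇒CycEdge a)

-- Polyhedral embeddings of cubic graphs

module CubicGraph {n} (G : Graph n) (cubic : Cubic G) where

  -- The neighbours are parameters in a chosen order, so that a lemma can single out the one a path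
  -- comes from, the one it goes to and the one left over.
  record Nbrs (v a b c : Fin n) : Set where
    constructor mkNbrs
    field
      adj₁ : Adj G v a
      adj₂ : Adj G v b
      adj₃ : Adj G v c
      1≢2 : a ≢ b
      1≢3 : a ≢ c
      2≢3 : b ≢ c
      complete : ∀ u → Adj G v u → u ≡ a ⊎ u ≡ b ⊎ u ≡ c

  open Nbrs public

  swap₁₂ : ∀ {v a b c} → Nbrs v a b c → Nbrs v b a c
  swap₁₂ N = mkNbrs (adj₂ N) (adj₁ N) (adj₃ N) (≢-sym (1≢2 N)) (2≢3 N) (1≢3 N) comp
    where
    comp : ∀ u → _ → _
    comp u uv with complete N u uv
    ... | inj₁ e = inj₂ (inj₁ e)
    ... | inj₂ (inj₁ e) = inj₁ e
    ... | inj₂ (inj₂ e) = inj₂ (inj₂ e)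

  swap₂₃ : ∀ {v a b c} → Nbrs v a b c → Nbrs v a c b
  swap₂₃ N = mkNbrs (adj₁ N) (adj₃ N) (adj₂ N) (1≢3 N) (1≢2 N) (≢-sym (2≢3 N)) comp
    where
    comp : ∀ u → _ → _
    comp u uv with complete N u uv
    ... | inj₁ e = inj₁ e
    ... | inj₂ (inj₁ e) = inj₂ (inj₂ e)
    ... | inj₂ (inj₂ e) = inj₂ (inj₁ e)

  subst-Nbrs : ∀ {v v′ a a′ b b′ c c′} → v ≡ v′ → a ≡ a′ → b ≡ b′ → c ≡ c′ → Nbrs v a b c → Nbrs v′ a′ b′ c′
  subst-Nbrs refl refl refl refl N = N

  nbrs : ∀ v → ∃ λ a → ∃₂ λ b c → Nbrs v a b c
  nbrs v with cubic v
  ... | a , b , c , ((a≢b ∷ a≢c ∷ []) ∷ (b≢c ∷ []) ∷ _) , va , vb , vc , comp =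
    a , b , c , mkNbrs va vb vc a≢b a≢c b≢c comp

  nbrs-from : ∀ {v a} → Adj G v a → ∃₂ (Nbrs v a)
  nbrs-from {v} {a} va with nbrs v
  ... | p , q , r , N with complete N a va
  ... | inj₁ refl = q , r , N
  ... | inj₂ (inj₁ refl) = p , r , swap₁₂ N
  ... | inj₂ (inj₂ refl) = p , q , swap₁₂ (swap₂₃ N)

  third : ∀ {v a b} → Adj G v a → Adj G v b → a ≢ b → ∃ (Nbrs v a b)
  third {v} {a} {b} va vb a≢b with nbrs-from va
  ... | p , q , N with complete N b vb
  ... | inj₁ b≡a = contradiction (sym b≡a) a≢b
  ... | inj₂ (inj₁ refl) = q , N
  ... | inj₂ (inj₂ refl) = p , swap₂₃ N

  nbrs-of-three : ∀ {v a b c} → Adj G v a → Adj G v b → Adj G v c → a ≢ b → a ≢ c → b ≢ c → Nbrs v a b c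
  nbrs-of-three {c = c} va vb vc a≢b a≢c b≢c with _ , N ← third va vb a≢b with complete N c vc
  ... | inj₁ e = contradiction (sym e) a≢c
  ... | inj₂ (inj₁ e) = contradiction (sym e) b≢c
  ... | inj₂ (inj₂ refl) = N

  Adj? : ∀ u v → Dec (Adj G u v)
  Adj? u v with nbrs u
  ... | a , b , c , N with v ≟ a | v ≟ b | v ≟ c
  ... | yes refl | _ | _ = yes (adj₁ N)
  ... | _ | yes refl | _ = yes (adj₂ N)
  ... | _ | _ | yes refl = yes (adj₃ N)
  ... | no p | no q | no r = no λ uv → no-case (complete N v uv)
    where
    no-case : ¬ (v ≡ a ⊎ v ≡ b ⊎ v ≡ c)
    no-case (inj₁ e) = p e
    no-case (inj₂ (inj₁ e)) = q e
    no-case (inj₂ (inj₂ e)) = r e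

  Adj⇒≢ : ∀ {u v} → Adj G u v → u ≢ v
  Adj⇒≢ uv refl = Adj-irrefl G uv

  module Polyhedral (Π : FaceSystem n) (poly : IsPolyhedral G Π) where

    private
      isCycle = proj₁ (proj₂ (proj₁ poly))
      twoFaces = proj₁ (proj₂ (proj₂ (proj₁ poly)))

    module Face j = Cycle (proj₁ (isCycle j)) (proj₁ (proj₂ (isCycle j)))

    EdgeOn⇒Adj : ∀ {j u v} → EdgeOn Π j u v → Adj G u v
    EdgeOn⇒Adj {j} (inj₁ h) = proj₂ (proj₂ (isCycle j)) _ _ h
    EdgeOn⇒Adj {j} (inj₂ h) = Adj-sym G (proj₂ (proj₂ (isCycle j)) _ _ h)

    -- Only the third alternative of `GoodIntersection` has room for two distinct vertices, and then
    -- they are the ends of its edge, up to order.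
    common⇒EdgeOn : ∀ {i j x y} → i ≢ j → x ≢ y →
      OnFace Π i x × OnFace Π j x → OnFace Π i y × OnFace Π j y →
      EdgeOn Π i x y × EdgeOn Π j x y × (∀ z → OnFace Π i z × OnFace Π j z → z ≡ x ⊎ z ≡ y)
    common⇒EdgeOn {i} {j} i≢j x≢y hx hy with proj₂ poly i j i≢j
    ... | inj₁ none = contradiction hx (none _)
    ... | inj₂ (inj₁ (_ , one)) = contradiction
      (trans (Equivalence.to (one _) hx) (sym (Equivalence.to (one _) hy))) x≢y
    ... | inj₂ (inj₂ (a , b , _ , two , ei , ej))
      with Equivalence.to (two _) hx | Equivalence.to (two _) hy
    ... | inj₁ refl | inj₁ refl = contradiction refl x≢y
    ... | inj₂ refl | inj₂ refl = contradiction refl x≢y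
    ... | inj₁ refl | inj₂ refl = ei , ej , λ z → Equivalence.to (two z)
    ... | inj₂ refl | inj₁ refl = Face.CycEdge-sym i ei , Face.CycEdge-sym j ej ,
      λ z hz → Sum.swap (Equivalence.to (two z) hz)

    EdgeOn⇒OnFace : ∀ {j u v} → EdgeOn Π j u v → OnFace Π j u
    EdgeOn⇒OnFace {j} = Face.CycEdge⇒∈ j

    EdgeOn-sym : ∀ {j u v} → EdgeOn Π j u v → EdgeOn Π j v u
    EdgeOn-sym {j} = Face.CycEdge-sym j

    -- Distinct faces would share the three vertices of the corner, but two faces meet in at most
    -- two.
    corner-unique : ∀ {i j v y z} → y ≢ z → EdgeOn Π i v y → EdgeOn Π i v z →
                    EdgeOn Π j v y → EdgeOn Π j v z → i ≡ j
    corner-unique {i} {j} {v} y≢z iy iz jy jz with i ≟ j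
    ... | yes i≡j = i≡j
    ... | no i≢j with common⇒EdgeOn i≢j (Adj⇒≢ (EdgeOn⇒Adj iy))
                      (EdgeOn⇒OnFace iy , EdgeOn⇒OnFace jy)
                      (EdgeOn⇒OnFace (EdgeOn-sym iy) , EdgeOn⇒OnFace (EdgeOn-sym jy))
    ... | _ , _ , only with only _ (EdgeOn⇒OnFace (EdgeOn-sym iz) , EdgeOn⇒OnFace (EdgeOn-sym jz))
    ... | inj₁ refl = contradiction (EdgeOn⇒Adj iz) (Adj-irrefl G)
    ... | inj₂ refl = contradiction refl y≢z

    -- The two faces through `vy` turn at `v` towards `x` or `z`; by `corner-unique` they cannot
    -- both turn towards `x`.
    corner : ∀ {v x y z} → Nbrs v x y z → ∃ λ j → EdgeOn Π j v y × EdgeOn Π j v z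
    corner {v} {x} {y} {z} N with twoFaces v y (adj₂ N)
    ... | i , j , i≢j , vyi , vyj , _
      with Face.second-CycEdge i (EdgeOn-sym vyi) | Face.second-CycEdge j (EdgeOn-sym vyj)
    ... | p , p≢y , vpi | q , q≢y , vqj
      with complete N p (EdgeOn⇒Adj vpi) | complete N q (EdgeOn⇒Adj vqj)
    ... | inj₂ (inj₂ refl) | _ = i , vyi , vpi
    ... | _ | inj₂ (inj₂ refl) = j , vyj , vqj
    ... | inj₂ (inj₁ e) | _ = contradiction e p≢y
    ... | _ | inj₂ (inj₁ e) = contradiction e q≢y
    ... | inj₁ refl | inj₁ refl = contradiction (corner-unique (≢-sym p≢y) vyi vpi vyj vqj) i≢j

    transport-corner : ∀ {j v x y z y′ z′} → Nbrs v x y z → Nbrs v x y′ z′ →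
      EdgeOn Π j v y → EdgeOn Π j v z → EdgeOn Π j v y′ × EdgeOn Π j v z′
    transport-corner M N vy vz with complete M _ (adj₂ N) | complete M _ (adj₃ N)
    ... | inj₁ e | _ = contradiction (sym e) (1≢2 N)
    ... | _ | inj₁ e = contradiction (sym e) (1≢3 N)
    ... | inj₂ (inj₁ refl) | inj₂ (inj₁ refl) = contradiction refl (2≢3 N)
    ... | inj₂ (inj₂ refl) | inj₂ (inj₂ refl) = contradiction refl (2≢3 N)
    ... | inj₂ (inj₁ refl) | inj₂ (inj₂ refl) = vy , vz
    ... | inj₂ (inj₂ refl) | inj₂ (inj₁ refl) = vz , vy

    abstract
      -- The face is chosen from `v` and `x` alone, before the other neighbours are named, so it
      -- does not depend on the order in which a neighbourhood is listed. Being abstract, it stays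
      -- opaque when faces are compared.
      opposite : ∀ v x → ∃ λ j → ∀ {y z} → Nbrs v x y z → EdgeOn Π j v y × EdgeOn Π j v z
      opposite v x with Adj? v x
      ... | yes vx with _ , _ , M ← nbrs-from vx with j , vy , vz ← corner M =
        j , λ N → transport-corner M N vy vz
      ... | no ¬vx with _ , _ , _ , M ← nbrs v =
        proj₁ (corner M) , λ N → contradiction (adj₁ N) ¬vx

    -- The face at v that avoids the edge vx (an arbitrary face at v when x is not a neighbour of v).
    F : Fin n → Fin n → Fin (nF Π)
    F v x = proj₁ (opposite v x)

    F-edges : ∀ {v x y z} → Nbrs v x y z → EdgeOn Π (F v x) v y × EdgeOn Π (F v x) v z
    F-edges {v} {x} N = proj₂ (opposite v x) N

    F-avoids : ∀ {v x} → Adj G v x → ¬ EdgeOn Π (F v x) v x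
    F-avoids {v} {x} va e with y , z , N ← nbrs-from va with f , g ← F-edges N =
      2≢3 N (Face.CycEdge-degree (F v x) e f g (1≢2 N) (1≢3 N))

    F-on : ∀ {v x} → Adj G v x → OnFace Π (F v x) v
    F-on va with _ , _ , N ← nbrs-from va = EdgeOn⇒OnFace (proj₁ (F-edges N))

    F-unique : ∀ {j v x y z} → Nbrs v x y z → EdgeOn Π j v y → EdgeOn Π j v z → j ≡ F v x
    F-unique N e f with e′ , f′ ← F-edges N = corner-unique (2≢3 N) e f e′ f′

    F-contains : ∀ {v x y} → Adj G v x → Adj G v y → x ≢ y → EdgeOn Π (F v x) v y
    F-contains vx vy x≢y with _ , N ← third vx vy x≢y = proj₁ (F-edges N)

    F-injective : ∀ {v x y} → Adj G v x → Adj G v y → x ≢ y → F v x ≢ F v y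
    F-injective {v} vx vy x≢y e =
      F-avoids vy (subst (λ j → EdgeOn Π j v _) e (F-contains vx vy x≢y))

    F-edge : ∀ {b c a a′ d d′} → Nbrs b c a a′ → Nbrs c b d d′ →
      (F b a′ ≡ F c d′ × F b a ≡ F c d) ⊎ (F b a′ ≡ F c d × F b a ≡ F c d′)
    F-edge {b} {c} {a} {a′} {d} {d′} N M with twoFaces b c (adj₁ N)
    ... | i , j , _ , _ , _ , only
      with only (F b a′) (F-contains (adj₃ N) (adj₁ N) (≢-sym (1≢3 N)))
         | only (F b a) (F-contains (adj₂ N) (adj₁ N) (≢-sym (1≢2 N)))
         | only (F c d′) (EdgeOn-sym (F-contains (adj₃ M) (adj₁ M) (≢-sym (1≢3 M))))
         | only (F c d) (EdgeOn-sym (F-contains (adj₂ M) (adj₁ M) (≢-sym (1≢2 M))))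
         | F-injective (adj₂ N) (adj₃ N) (2≢3 N) | F-injective (adj₂ M) (adj₃ M) (2≢3 M)
    ... | inj₁ p | inj₁ q | _ | _ | ≢N | _ = contradiction (trans q (sym p)) ≢N
    ... | inj₂ p | inj₂ q | _ | _ | ≢N | _ = contradiction (trans q (sym p)) ≢N
    ... | _ | _ | inj₁ r | inj₁ s | _ | ≢M = contradiction (trans s (sym r)) ≢M
    ... | _ | _ | inj₂ r | inj₂ s | _ | ≢M = contradiction (trans s (sym r)) ≢M
    ... | inj₁ p | inj₂ q | inj₁ r | inj₂ s | _ | _ = inj₁ (trans p (sym r) , trans q (sym s))
    ... | inj₂ p | inj₁ q | inj₂ r | inj₁ s | _ | _ = inj₁ (trans p (sym r) , trans q (sym s))
    ... | inj₁ p | inj₂ q | inj₂ r | inj₁ s | _ | _ = inj₂ (trans p (sym s) , trans q (sym r))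
    ... | inj₂ p | inj₁ q | inj₁ r | inj₂ s | _ | _ = inj₂ (trans p (sym s) , trans q (sym r))

    shared-two⇒Adj : ∀ {v w x y p q} → v ≢ w → Adj G v x → Adj G v y → x ≢ y →
      Adj G w p → Adj G w q → F v x ≡ F w p → F v y ≡ F w q → Adj G v w
    shared-two⇒Adj {v} {w} v≢w vx vy x≢y wp wq e f = EdgeOn⇒Adj (proj₁
      (common⇒EdgeOn (F-injective vx vy x≢y) v≢w (F-on vx , F-on vy)
        (subst (λ j → OnFace Π j w) (sym e) (F-on wp) , subst (λ j → OnFace Π j w) (sym f) (F-on wq))))

    -- For another neighbour `y` of `v`, the face `F v y` contains the edge `vw`. If `F v w`
    -- contained `w`, the two faces would share `v` and `w`, and polyhedrality would put the edge
    -- `vw` on `F v w`.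
    F-avoids-vertex : ∀ {v w q} → Adj G v w → Adj G w q → F v w ≢ F w q
    F-avoids-vertex {v} {w} {q} vw wq e with y , _ , N ← nbrs-from vw =
      F-avoids vw (proj₁ (common⇒EdgeOn (F-injective vw (adj₂ N) (1≢2 N)) (Adj⇒≢ vw)
        (F-on vw , F-on (adj₂ N))
        (subst (λ j → OnFace Π j w) (sym e) (F-on wq) ,
         EdgeOn⇒OnFace (EdgeOn-sym (F-contains (adj₂ N) vw (≢-sym (1≢2 N)))))))

    FacialSub⇒F : ∀ {a b c d o o′} → Nbrs b a c o → Nbrs c b d o′ →
      FacialSub Π (a ∷ b ∷ c ∷ d ∷ []) → F b o ≡ F c o′
    FacialSub⇒F N M (j , h) with ab , bc , cd ← Face.CycSub⇒CycEdges j h =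
      trans (sym (F-unique (swap₁₂ (swap₂₃ N)) (EdgeOn-sym ab) bc))
            (F-unique (swap₁₂ (swap₂₃ M)) (EdgeOn-sym bc) cd)

    F⇒FacialPath : ∀ {a b c d o o′} → a ≢ d → Nbrs b a c o → Nbrs c b d o′ →
      F b o ≡ F c o′ → FacialPath G Π a b c d
    F⇒FacialPath {a} {b} {c} {d} {o} {o′} a≢d N M e =
      (((≢-sym (Adj⇒≢ (adj₁ N)) ∷ 1≢2 N ∷ a≢d ∷ []) ∷ (Adj⇒≢ (adj₂ N) ∷ 1≢2 M ∷ []) ∷
        (Adj⇒≢ (adj₂ M) ∷ []) ∷ [] ∷ []) , Adj-sym G (adj₁ N) , adj₂ N , adj₂ M) ,
      F b o , Face.CycEdges⇒CycSub (F b o) (1≢2 N) a≢d (1≢2 M)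
        (EdgeOn-sym (F-contains (adj₃ N) (adj₁ N) (≢-sym (1≢3 N))))
        (F-contains (adj₃ N) (adj₂ N) (≢-sym (2≢3 N)))
        (subst (λ j → EdgeOn Π j c d) (sym e) (F-contains (adj₃ M) (adj₂ M) (≢-sym (2≢3 M))))

    path-nbrs : ∀ {a b c d} → IsPath4 G a b c d → ∃₂ λ o o′ → Nbrs b a c o × Nbrs c b d o′
    path-nbrs (((_ ∷ a≢c ∷ _) ∷ (_ ∷ b≢d ∷ []) ∷ _) , ab , bc , cd)
      with o , N ← third (Adj-sym G ab) bc a≢c | o′ , M ← third (Adj-sym G bc) cd b≢d = o , o′ , N , M

    -- The corner `a b c` fixes the face, and at `c` this face avoids one of the two edges by which
    -- a path can leave.
    FacialSub-exclusive : ∀ {a b c d d′} → IsPath4 G a b c d → IsPath4 G a b c d′ → d ≢ d′ →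
      FacialSub Π (a ∷ b ∷ c ∷ d ∷ []) → ¬ FacialSub Π (a ∷ b ∷ c ∷ d′ ∷ [])
    FacialSub-exclusive p p′@(_ , _ , _ , cd′) d≢d′ h h′
      with _ , _ , N , M ← path-nbrs p
      with complete M _ cd′
    ... | inj₁ refl with (_ ∷ (_ ∷ b≢b ∷ _) ∷ _) , _ ← p′ = contradiction refl b≢b
    ... | inj₂ (inj₁ e) = d≢d′ (sym e)
    ... | inj₂ (inj₂ refl) = F-injective (adj₃ M) (adj₂ M) (≢-sym (2≢3 M))
      (trans (sym (FacialSub⇒F N M h)) (FacialSub⇒F N (swap₂₃ M) h′))

    -- Comparing the indices `F b o` and `F c o′` replaces a search through all faces.
    FacialPath? : ∀ a b c d → Dec (FacialPath G Π a b c d)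
    FacialPath? a b c d with Unique? (a ∷ b ∷ c ∷ d ∷ []) | Adj? a b | Adj? b c | Adj? c d
      where
      open import Data.List.Relation.Unary.Unique.DecPropositional (_≟_ {n}) using ()
        renaming (unique? to Unique?)
    ... | no ¬u | _ | _ | _ = no λ { ((u , _) , _) → ¬u u }
    ... | _ | no ¬e | _ | _ = no λ { ((_ , e , _) , _) → ¬e e }
    ... | _ | _ | no ¬e | _ = no λ { ((_ , _ , e , _) , _) → ¬e e }
    ... | _ | _ | _ | no ¬e = no λ { ((_ , _ , _ , e) , _) → ¬e e }
    ... | yes u@((_ ∷ _ ∷ a≢d ∷ []) ∷ _) | yes ab | yes bc | yes cd
      with o , o′ , N , M ← path-nbrs (u , ab , bc , cd)
      with F b o ≟ F c o′
    ... | yes e = yes (F⇒FacialPath a≢d N M e)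
    ... | no ¬e = no λ { (_ , h) → ¬e (FacialSub⇒F N M h) }

-- Multiplicities of scaffold edges

Unique-⊆-length : ∀ {A : Set} {xs ys : List A} → Unique xs → xs ⊆ ys → length xs ≤ length ys
Unique-⊆-length {xs = []} _ _ = z≤n
Unique-⊆-length {xs = x ∷ xs} (x∉ ∷ u) sub with as , bs , refl ← ∈-∃++ (sub (here refl)) =
  ℕ.≤-trans (s≤s (Unique-⊆-length u rest)) (ℕ.≤-reflexive (trans
    (cong suc (length-++ as)) (trans (sym (ℕ.+-suc (length as) (length bs))) (sym (length-++ as)))))
  where
  rest : xs ⊆ as ++ bs
  rest y∈ with ∈-++⁻ as (sub (there y∈))
  ... | inj₁ p = ∈-++⁺ˡ p
  ... | inj₂ (here refl) = contradiction refl (All.lookup x∉ y∈)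
  ... | inj₂ (there p) = ∈-++⁺ʳ as p

module _ {n} (G : Graph n) where

  SameExtended-sym : ∀ {Π Π′} → SameExtended G Π Π′ → SameExtended G Π′ Π
  SameExtended-sym same u w k u≢w = mk⇔ (Equivalence.from (same u w k u≢w)) (Equivalence.to (same u w k u≢w))

  SameExtended-trans : ∀ {Π Π′ Π″} → SameExtended G Π Π′ → SameExtended G Π′ Π″ → SameExtended G Π Π″
  SameExtended-trans same same′ u w k u≢w = mk⇔
    (Equivalence.to (same′ u w k u≢w) ∘ Equivalence.to (same u w k u≢w))
    (Equivalence.from (same u w k u≢w) ∘ Equivalence.from (same′ u w k u≢w))

  module _ (Π : FaceSystem n) {u w : Fin n} where

    Mult-lower : ∀ {k L} → Mult G Π u w k → Unique L →
      (∀ {p} → p ∈ L → FacialPath G Π u (proj₁ p) (proj₂ p) w) → length L ≤ k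
    Mult-lower (K , _ , refl , mem) uL facial =
      Unique-⊆-length uL (λ p∈ → Equivalence.from (mem _) (facial p∈))

    Mult-upper : ∀ {k L} → Mult G Π u w k →
      (∀ {p} → FacialPath G Π u (proj₁ p) (proj₂ p) w → p ∈ L) → k ≤ length L
    Mult-upper (K , uK , refl , mem) cover =
      Unique-⊆-length uK (λ p∈ → cover (Equivalence.to (mem _) p∈))

    Mult-functional : ∀ {k k′} → Mult G Π u w k → Mult G Π u w k′ → k ≡ k′
    Mult-functional m m′ = ℕ.≤-antisym (below m m′) (below m′ m)
      where
      below : ∀ {k k′} → Mult G Π u w k → Mult G Π u w k′ → k ≤ k′
      below (K , uK , refl , mem) m′ = Mult-lower m′ uK (Equivalence.to (mem _))

module Counting {n} (G : Graph n) (cubic : Cubic G) where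

  open CubicGraph G cubic

  multiplicity : ∀ Π → IsPolyhedral G Π → ∀ u w → ∃ (Mult G Π u w)
  multiplicity Π poly u w = length K , K , filter⁺ facial? (cartesianProduct⁺ (allFin⁺ n) (allFin⁺ n)) , refl ,
      λ p → mk⇔ (λ p∈ → proj₂ (∈-filter⁻ facial? {xs = pairs} p∈))
        (λ h → ∈-filter⁺ facial? (∈-cartesianProduct⁺ (∈-allFin (proj₁ p)) (∈-allFin (proj₂ p))) h)
    where
    open Polyhedral Π poly using (FacialPath?)
    facial? : (p : Fin n × Fin n) → Dec (FacialPath G Π u (proj₁ p) (proj₂ p) w)
    facial? (b , c) = FacialPath? u b c w
    pairs = cartesianProduct (allFin n) (allFin n)
    K = filter facial? pairs

  -- The common multiplicity is at least the number of paths exhibited in `Π` and at most the number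
  -- of candidates left in `Π′`. This is how the equality of extended graphs enters the case
  -- analysis.
  facial-count-≤ : ∀ {Π Π′} → IsPolyhedral G Π → SameExtended G Π Π′ → ∀ {u w} → u ≢ w →
    ∀ {L M} → Unique L → (∀ {p} → p ∈ L → FacialPath G Π u (proj₁ p) (proj₂ p) w) →
    (∀ {p} → FacialPath G Π′ u (proj₁ p) (proj₂ p) w → p ∈ M) → length L ≤ length M
  facial-count-≤ {Π} {Π′} poly same {u} {w} u≢w uL facial cover with k , m ← multiplicity Π poly u w =
    ℕ.≤-trans (Mult-lower G Π m uL facial) (Mult-upper G Π′ (Equivalence.to (same u w k u≢w) m) cover)

-- The case analysis as a checked certificate

-- Vertices are denoted by numbers: 0 … 8 are t0, t0', t1, t2, t3, t4, t4', t5, t5', the number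
-- 16 + i is the neighbour of vertex i outside the two 6-cycles, and 32 + i and 48 + i denote the
-- further neighbours of a vertex i met later.
Row Key : Set
Row = ℕ × ℕ × ℕ × ℕ
Key = ℕ × ℕ

data Emb : Set where
  A B : Emb

other : Emb → Emb
other A = B
other B = A

-- What is known on a branch: rows v, a, b, c (the neighbours of v are a, b, c); the explored
-- vertices, which are pairwise distinct (other numbers may turn out to denote one of them); pairs
-- (x , v) with v a neighbour of x; and, for A and B, equations F v x ≡ F w y between faces, solved
-- from left to right by rep.  This is not a record, as η-equality would destroy the sharing on
-- which evaluating the certificate depends.
data State : Set where
  state : List Row → List ℕ → List (ℕ × ℕ) → List (Key × Key) → List (Key × Key) → State

rows : State → List Row
rows (state rs _ _ _ _) = rs

real : State → List ℕ
real (state _ is _ _ _) = is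

half : State → List (ℕ × ℕ)
half (state _ _ hs _ _) = hs

eqs : State → Emb → List (Key × Key)
eqs (state _ _ _ as _) A = as
eqs (state _ _ _ _ bs) B = bs

addRow : Row → State → State
addRow r (state rs is hs as bs) = state (r ∷ rs) is hs as bs

addReal : ℕ → ℕ → State → State
addReal s v (state rs is hs as bs) = state rs (is ∷ʳ s) ((s , v) ∷ hs) as bs

-- `addEq` reduces both sides by the earlier equations before storing a new one, so one pass
-- suffices. A `rename` may spoil this order, which costs completeness only: `rep-sound` does not
-- rely on it.
rep : List (Key × Key) → Key → Key
rep [] k = k
rep (((v , x) , l) ∷ es) (w , y) with v ℕ.≟ w | x ℕ.≟ y
... | yes _ | yes _ = rep es l
... | _ | _ = rep es (w , y)

addEq : Emb → Key → Key → State → State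
addEq A k l (state rs is hs as bs) = state rs is hs (as ∷ʳ (rep as k , rep as l)) bs
addEq B k l (state rs is hs as bs) = state rs is hs as (bs ∷ʳ (rep bs k , rep bs l))

module _ (s j : ℕ) where
  ren : ℕ → ℕ
  ren i with i ℕ.≟ s
  ... | yes _ = j
  ... | no _ = i

  renRow : Row → Row
  renRow (v , a , b , c) = ren v , ren a , ren b , ren c

  renKey : Key → Key
  renKey (v , x) = ren v , ren x

  renEq : Key × Key → Key × Key
  renEq (k , l) = renKey k , renKey l

  rename : State → State
  rename (state rs is hs as bs) = state (map renRow rs) is (map renKey hs) (map renEq as) (map renEq bs)

-- edge e b c splits over the choice at the edge bc in the embedding e; stub v s over which explored
-- vertex, if any, the neighbour s of v is; grow x names the two unknown neighbours of x.  The other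
-- constructors close a branch:
--   dup e v x y:          F v x ≡ F v y for distinct neighbours x and y of v;
--   adj e v w q:          F v w ≡ F w q for adjacent v and w;
--   two e v w x y p q:    F v x ≡ F w p and F v y ≡ F w q, but v and w are not adjacent;
--   scaf e u w L:         L lists more facial paths from u to w in e than the other embedding can have;
--   forb e b c:           the path t0' b c t3 is facial;
--   done:                 the Franklin graph has been reached.
data Cert : Set where
  edge : Emb → ℕ → ℕ → Cert → Cert → Cert
  stub : ℕ → ℕ → List Cert → Cert
  grow : ℕ → Cert → Cert
  dup : Emb → ℕ → ℕ → ℕ → Cert
  adj : Emb → ℕ → ℕ → ℕ → Cert
  two : Emb → ℕ → ℕ → ℕ → ℕ → ℕ → ℕ → Cert
  scaf : Emb → ℕ → ℕ → List (ℕ × ℕ) → Cert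
  forb : Emb → ℕ → ℕ → Cert
  done : Cert

-- Flipping the branches lets the shorter one come first in the certificate, with the longer one
-- after `$`.
edgeˢ : Emb → ℕ → ℕ → Cert → Cert → Cert
edgeˢ e b c k l = edge e b c l k

-- Partial tests that return proofs

module _ {a p} {X : Set a} {P : X → Set p} (f : ∀ x → Maybe (P x)) where

  allᴹ : ∀ xs → Maybe (All P xs)
  allᴹ [] = just []
  allᴹ (x ∷ xs) = do
    p ← f x
    ps ← allᴹ xs
    just (p ∷ ps)

  sift : List X → List X
  sift [] = []
  sift (x ∷ xs) with f x
  ... | just _ = sift xs
  ... | nothing = x ∷ sift xs

  sift-complete : ∀ {x xs} → x ∈ xs → P x ⊎ x ∈ sift xs
  sift-complete {xs = y ∷ xs} x∈ with f y
  sift-complete (here refl) | just p = inj₁ p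
  sift-complete (here refl) | nothing = inj₂ (here refl)
  sift-complete (there x∈) | just p = sift-complete x∈
  sift-complete (there x∈) | nothing with sift-complete x∈
  ... | inj₁ p = inj₁ p
  ... | inj₂ q = inj₂ (there q)

∀Finᴹ : ∀ {p m} {P : Fin m → Set p} → (∀ i → Maybe (P i)) → Maybe (∀ i → P i)
∀Finᴹ {m = zero} f = just λ ()
∀Finᴹ {m = suc m} f = do
  p ← f zero
  ps ← ∀Finᴹ (f ∘ suc)
  just λ { zero → p ; (suc i) → ps i }

distinct : ∀ i k → Maybe (i ≢ k)
distinct i k with i ℕ.≟ k
... | yes _ = nothing
... | no i≢k = just i≢k

member : ∀ i l → Maybe (i ∈ l)
member i [] = nothing
member i (j ∷ l) with i ℕ.≟ j
... | yes e = just (here e)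
... | no _ with member i l
... | just i∈ = just (there i∈)
... | nothing = nothing

record Target : Set where
  field
    size : ℕ
    label : Fin size → ℕ
    label-injective : ∀ i j → label i ≡ label j → i ≡ j
    adjacent : Fin size → Fin size × Fin size × Fin size
    facial : List (Fin size × Fin size × Fin size × Fin size)

-- Interpretation of states and soundness of the search

module Search {n} (G : Graph n) (cubic : Cubic G)
  (S : Emb → FaceSystem n) (poly : ∀ e → IsPolyhedral G (S e))
  (same : ∀ e → SameExtended G (S e) (S (other e)))
  (ρ₀ : ℕ → Fin n) (target : Target)
  (unscaffolded : ∀ e b c → ¬ FacialPath G (S e) (ρ₀ 1) b c (ρ₀ 4)) where

  open CubicGraph G cubic
  open Counting G cubic
  module E e = Polyhedral (S e) (poly e)
  open Target target

  V : Fin size → Fin n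
  V i = ρ₀ (label i)

  record Goal : Set where
    field
      V-injective : ∀ i j → V i ≡ V j → i ≡ j
      V-nbrs : ∀ i → Nbrs (V i) (V (proj₁ (adjacent i))) (V (proj₁ (proj₂ (adjacent i)))) (V (proj₂ (proj₂ (adjacent i))))
      V-facial : All (λ (a , b , c , d) → FacialPath G (S A) (V a) (V b) (V c) (V d)) facial

  Env : Set
  Env = ℕ → Fin n

  FK : ∀ e → Env → Key → Fin (nF (S e))
  FK e ρ (v , x) = E.F e (ρ v) (ρ x)

  NbrsRow : Env → Row → Set
  NbrsRow ρ (v , a , b , c) = Nbrs (ρ v) (ρ a) (ρ b) (ρ c)

  AdjKey : Env → Key → Set
  AdjKey ρ (x , v) = Adj G (ρ x) (ρ v)

  EqK : ∀ e → Env → Key × Key → Set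
  EqK e ρ (k , l) = FK e ρ k ≡ FK e ρ l

  -- `base` keeps the numbers below 32 at their meaning under `ρ₀`, to which `Goal` and
  -- `unscaffolded` refer; larger numbers receive a meaning during exploration.
  record Model (ρ : Env) (σ : State) : Set where
    field
      base : ∀ i → i < 32 → ρ i ≡ ρ₀ i
      rows✓ : All (NbrsRow ρ) (rows σ)
      real✓ : ∀ {i j} → i ∈ real σ → j ∈ real σ → ρ i ≡ ρ j → i ≡ j
      half✓ : All (AdjKey ρ) (half σ)
      eqs✓ : ∀ e → All (EqK e ρ) (eqs σ e)
  open Model

  -- A contradictory branch satisfies this vacuously and a `done` branch by reaching the goal, so
  -- both kinds of leaf have one type.
  Refuted : State → Set
  Refuted σ = ∀ {ρ} → Model ρ σ → Goal

  Holds : State → (Env → Set) → Set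
  Holds σ P = ∀ {ρ} → Model ρ σ → P ρ

  rep-sound : ∀ {e ρ} es → All (EqK e ρ) es → ∀ k → FK e ρ k ≡ FK e ρ (rep es k)
  rep-sound [] [] k = refl
  rep-sound (((v , x) , l) ∷ es) (p ∷ ps) (w , y) with v ℕ.≟ w | x ℕ.≟ y
  ... | yes refl | yes refl = trans p (rep-sound es ps l)
  ... | yes _ | no _ = rep-sound es ps (w , y)
  ... | no _ | _ = rep-sound es ps (w , y)

  addEq-model : ∀ e {k l σ ρ} → Model ρ σ → EqK e ρ (k , l) → Model ρ (addEq e k l σ)
  addEq-model A {k} {l} {state _ _ _ as _} m p = record
    { base = base m ; rows✓ = rows✓ m ; real✓ = real✓ m ; half✓ = half✓ m
    ; eqs✓ = λ { A → All.∷ʳ⁺ (eqs✓ m A) (trans (sym (rep-sound as (eqs✓ m A) k)) (trans p (rep-sound as (eqs✓ m A) l)))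
               ; B → eqs✓ m B } }
  addEq-model B {k} {l} {state _ _ _ _ bs} m p = record
    { base = base m ; rows✓ = rows✓ m ; real✓ = real✓ m ; half✓ = half✓ m
    ; eqs✓ = λ { B → All.∷ʳ⁺ (eqs✓ m B) (trans (sym (rep-sound bs (eqs✓ m B) k)) (trans p (rep-sound bs (eqs✓ m B) l)))
               ; A → eqs✓ m A } }

  addRow-model : ∀ r {σ ρ} → Model ρ σ → NbrsRow ρ r → Model ρ (addRow r σ)
  addRow-model r {state _ _ _ _ _} m p = record
    { base = base m ; rows✓ = p ∷ rows✓ m ; real✓ = real✓ m ; half✓ = half✓ m
    ; eqs✓ = λ { A → eqs✓ m A ; B → eqs✓ m B } }

  addReal-model : ∀ {s v σ ρ} → Model ρ σ → AdjKey ρ (s , v) →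
    (∀ {j} → j ∈ real σ → ρ s ≢ ρ j) → Model ρ (addReal s v σ)
  addReal-model {s} {v} {σ@(state _ _ _ _ _)} {ρ} m p new = record
    { base = base m ; rows✓ = rows✓ m ; real✓ = λ i∈ j∈ → inj (∈-∷ʳ⁻ i∈) (∈-∷ʳ⁻ j∈) ; half✓ = p ∷ half✓ m
    ; eqs✓ = λ { A → eqs✓ m A ; B → eqs✓ m B } }
    where
    open import Data.List.Membership.Propositional.Properties using (∈-++⁻)
    ∈-∷ʳ⁻ : ∀ {i} → i ∈ real σ ∷ʳ s → i ∈ real σ ⊎ i ≡ s
    ∈-∷ʳ⁻ i∈ with ∈-++⁻ (real σ) i∈
    ... | inj₁ h = inj₁ h
    ... | inj₂ (here e) = inj₂ e
    inj : ∀ {i j} → i ∈ real σ ⊎ i ≡ s → j ∈ real σ ⊎ j ≡ s → ρ i ≡ ρ j → i ≡ j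
    inj (inj₁ i∈) (inj₁ j∈) e = real✓ m i∈ j∈ e
    inj (inj₁ i∈) (inj₂ refl) e = contradiction (sym e) (new i∈)
    inj (inj₂ refl) (inj₁ j∈) e = contradiction e (new j∈)
    inj (inj₂ refl) (inj₂ refl) e = refl

  module _ {s j : ℕ} {ρ : Env} (ρs≡ρj : ρ s ≡ ρ j) where

    ren-env : ∀ i → ρ (ren s j i) ≡ ρ i
    ren-env i with i ℕ.≟ s
    ... | yes refl = sym ρs≡ρj
    ... | no _ = refl

    renRow-sound : ∀ r → NbrsRow ρ r → NbrsRow ρ (renRow s j r)
    renRow-sound (v , a , b , c) N
      rewrite ren-env v | ren-env a | ren-env b | ren-env c = N

    renEq-sound : ∀ e p → EqK e ρ p → EqK e ρ (renEq s j p)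
    renEq-sound e ((v , x) , (w , y)) q
      rewrite ren-env v | ren-env x | ren-env w | ren-env y = q

    renKey-sound : ∀ k → AdjKey ρ k → AdjKey ρ (renKey s j k)
    renKey-sound (v , x) q rewrite ren-env v | ren-env x = q

    -- The environment stays as it is: `s` and `j` already denote one vertex, and only the name used
    -- for it changes.
    rename-model : ∀ {σ} → Model ρ σ → Model ρ (rename s j σ)
    rename-model {state _ _ _ _ _} m = record
      { base = base m ; rows✓ = All.map⁺ (All.map (renRow-sound _) (rows✓ m)) ; real✓ = real✓ m
      ; half✓ = All.map⁺ (All.map (renKey-sound _) (half✓ m))
      ; eqs✓ = λ { A → All.map⁺ (All.map (renEq-sound A _) (eqs✓ m A))
                 ; B → All.map⁺ (All.map (renEq-sound B _) (eqs✓ m B)) } }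

  _[_↦_] : Env → ℕ → Fin n → Env
  (ρ [ k ↦ y ]) i with i ℕ.≟ k
  ... | yes _ = y
  ... | no _ = ρ i

  update-same : ∀ ρ k y → (ρ [ k ↦ y ]) k ≡ y
  update-same ρ k y with k ℕ.≟ k
  ... | yes _ = refl
  ... | no k≢k = contradiction refl k≢k

  update-other : ∀ ρ {k} y {i} → i ≢ k → (ρ [ k ↦ y ]) i ≡ ρ i
  update-other ρ {k} y {i} i≢k with i ℕ.≟ k
  ... | yes i≡k = contradiction i≡k i≢k
  ... | no _ = refl


  -- Freshness is tested on the whole state instead of being carried as an invariant. The bound 32
  -- protects `base`.
  fresh : ∀ σ k → Maybe (∀ {ρ} y → Model ρ σ → Model (ρ [ k ↦ y ]) σ)
  fresh σ k = do
    32≤k ← dec⇒maybe (32 ≤? k)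
    rs ← allᴹ freshRow (rows σ)
    is ← allᴹ (λ i → distinct i k) (real σ)
    hs ← allᴹ freshKey (half σ)
    as ← allᴹ (freshEq A) (eqs σ A)
    bs ← allᴹ (freshEq B) (eqs σ B)
    just λ {ρ} y m → record
      { base = λ i i<32 → trans (update-other ρ y λ { refl → ℕ.<-irrefl refl (ℕ.<-≤-trans i<32 32≤k) }) (base m i i<32)
      ; rows✓ = All.zipWith (λ (f , p) → f y p) (rs , rows✓ m)
      ; real✓ = λ i∈ j∈ e → real✓ m i∈ j∈ (trans (sym (update-other ρ y (All.lookup is i∈)))
                                           (trans e (update-other ρ y (All.lookup is j∈))))
      ; half✓ = All.zipWith (λ (f , p) → f y p) (hs , half✓ m)
      ; eqs✓ = λ { A → All.zipWith (λ (f , p) → f y p) (as , eqs✓ m A)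
                 ; B → All.zipWith (λ (f , p) → f y p) (bs , eqs✓ m B) } }
    where
    freshRow : ∀ r → Maybe (∀ {ρ} y → NbrsRow ρ r → NbrsRow (ρ [ k ↦ y ]) r)
    freshRow (v , a , b , c) = do
      v≢ ← distinct v k
      a≢ ← distinct a k
      b≢ ← distinct b k
      c≢ ← distinct c k
      just λ {ρ} y N → subst-Nbrs (sym (update-other ρ y v≢)) (sym (update-other ρ y a≢))
        (sym (update-other ρ y b≢)) (sym (update-other ρ y c≢)) N
    freshKey : ∀ p → Maybe (∀ {ρ} y → AdjKey ρ p → AdjKey (ρ [ k ↦ y ]) p)
    freshKey (v , x) = do
      v≢ ← distinct v k
      x≢ ← distinct x k
      just λ {ρ} y → subst id (cong₂ (Adj G) (sym (update-other ρ y v≢)) (sym (update-other ρ y x≢)))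
    freshEq : ∀ e p → Maybe (∀ {ρ} y → EqK e ρ p → EqK e (ρ [ k ↦ y ]) p)
    freshEq e ((v , x) , (w , z)) = do
      v≢ ← distinct v k
      x≢ ← distinct x k
      w≢ ← distinct w k
      z≢ ← distinct z k
      just λ {ρ} y q → trans (cong₂ (E.F e) (update-other ρ y v≢) (update-other ρ y x≢))
        (trans q (sym (cong₂ (E.F e) (update-other ρ y w≢) (update-other ρ y z≢))))

  apart : ∀ σ i j → Maybe (Holds σ λ ρ → ρ i ≢ ρ j)
  apart σ i j = do
    i∈ ← member i (real σ)
    j∈ ← member j (real σ)
    i≢j ← distinct i j
    just λ m e → i≢j (real✓ m i∈ j∈ e)

  assoc : ∀ {X : Set} v (l : List (ℕ × X)) → Maybe (∃ λ x → (v , x) ∈ l)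
  assoc v [] = nothing
  assoc v ((w , x) ∷ l) with v ℕ.≟ w
  ... | yes refl = just (x , here refl)
  ... | no _ = do
    x , x∈ ← assoc v l
    just (x , there x∈)

  row : ∀ σ v → Maybe (∃ λ a → ∃₂ λ b c → Holds σ λ ρ → NbrsRow ρ (v , a , b , c))
  row σ v = do
    (a , b , c) , r∈ ← assoc v (rows σ)
    just (a , b , c , λ m → All.lookup (rows✓ m) r∈)

  around : ∀ σ v a → Maybe (∃₂ λ b c → Holds σ λ ρ → NbrsRow ρ (v , a , b , c))
  around σ v a = row σ v >>= select
    where
    select : _ → _
    select (p , q , r , N) with a ℕ.≟ p | a ℕ.≟ q | a ℕ.≟ r
    ... | yes refl | _ | _ = just (q , r , N)
    ... | _ | yes refl | _ = just (p , r , swap₁₂ ∘ N)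
    ... | _ | _ | yes refl = just (p , q , swap₁₂ ∘ swap₂₃ ∘ N)
    ... | _ | _ | _ = nothing

  arrange : ∀ σ v a b → Maybe (∃ λ c → Holds σ λ ρ → NbrsRow ρ (v , a , b , c))
  arrange σ v a b = around σ v a >>= select
    where
    select : _ → _
    select (p , q , N) with b ℕ.≟ p | b ℕ.≟ q
    ... | yes refl | _ = just (q , N)
    ... | _ | yes refl = just (p , swap₂₃ ∘ N)
    ... | _ | _ = nothing

  equal : ∀ σ e k l → Maybe (Holds σ λ ρ → EqK e ρ (k , l))
  equal σ e k l = compare (rep (eqs σ e) k) (rep (eqs σ e) l) refl refl
    where
    compare : ∀ p q → rep (eqs σ e) k ≡ p → rep (eqs σ e) l ≡ q → Maybe (Holds σ λ ρ → EqK e ρ (k , l))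
    compare (v , x) (w , y) k≡ l≡ with v ℕ.≟ w | x ℕ.≟ y
    ... | yes refl | yes refl = just λ {ρ} m → trans (rep-sound (eqs σ e) (eqs✓ m e) k)
      (trans (cong (FK e ρ) (trans k≡ (sym l≡))) (sym (rep-sound (eqs σ e) (eqs✓ m e) l)))
    ... | _ | _ = nothing

  facialPath : ∀ σ e a b c d → Maybe (Holds σ λ ρ → FacialPath G (S e) (ρ a) (ρ b) (ρ c) (ρ d))
  facialPath σ e a b c d = do
    o , N ← arrange σ b a c
    o′ , M ← arrange σ c b d
    a≢d ← apart σ a d
    q ← equal σ e (b , o) (c , o′)
    just λ m → E.F⇒FacialPath e (a≢d m) (N m) (M m) (q m)

  NotFacial : State → Emb → ℕ → ℕ → ℕ × ℕ → Set
  NotFacial σ e u w (b , c) = Holds σ λ ρ → ¬ FacialPath G (S e) (ρ u) (ρ b) (ρ c) (ρ w)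

  nonadjacent : ∀ σ b c → Maybe (Holds σ λ ρ → ¬ Adj G (ρ b) (ρ c))
  nonadjacent σ b c = do
    p , q , r , N ← row σ b
    c≢p ← apart σ c p
    c≢q ← apart σ c q
    c≢r ← apart σ c r
    just λ m bc → [ c≢p m , [ c≢q m , c≢r m ]′ ]′ (complete (N m) _ bc)

  -- The grounds for exclusion are a degenerate path, a missing middle edge, and, in `turned`, a
  -- face at the corner `u b c` that avoids the edge `cw`. Adjacency is tested from both ends
  -- because perhaps only one of them has a fully explored row.
  notFacial : ∀ σ e u w p → Maybe (NotFacial σ e u w p)
  notFacial σ e u w (b , c) = degenerate <∣> nonadj <∣> nonadj′ <∣> turned
    where
    degenerate : Maybe (NotFacial σ e u w (b , c))
    degenerate with b ℕ.≟ w | c ℕ.≟ u | b ℕ.≟ c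
    ... | yes refl | _ | _ = just λ { _ (((_ ∷ (_ ∷ b≢w ∷ []) ∷ _) , _) , _) → b≢w refl }
    ... | _ | yes refl | _ = just λ { _ ((((_ ∷ u≢c ∷ _) ∷ _) , _) , _) → u≢c refl }
    ... | _ | _ | yes refl = just λ { _ ((_ , _ , bc , _) , _) → Adj-irrefl G bc }
    ... | _ | _ | _ = nothing
    nonadj nonadj′ turned : Maybe (NotFacial σ e u w (b , c))
    nonadj = do
      ¬bc ← nonadjacent σ b c
      just λ { m ((_ , _ , bc , _) , _) → ¬bc m bc }
    nonadj′ = do
      ¬cb ← nonadjacent σ c b
      just λ { m ((_ , _ , bc , _) , _) → ¬cb m (Adj-sym G bc) }
    turned = do
      o , N ← arrange σ b u c
      o′ , M ← arrange σ c b w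
      q ← equal σ e (b , o) (c , w)
      just λ { m (_ , h) → E.F-injective e (adj₂ (M m)) (adj₃ (M m)) (2≢3 (M m))
        (trans (sym (q m)) (E.FacialSub⇒F e (N m) (M m) h)) }

  ρ² : Env → ℕ × ℕ → Fin n × Fin n
  ρ² ρ (b , c) = ρ b , ρ c

  distinctPairs : ∀ σ L → Maybe (Holds σ λ ρ → Unique (map (ρ² ρ) L))
  distinctPairs σ [] = just λ _ → []
  distinctPairs σ (p ∷ L) = do
    ps ← allᴹ (pairApart p) L
    u ← distinctPairs σ L
    just λ m → All.map⁺ (All.map (λ f → f m) ps) ∷ u m
    where
    pairApart : ∀ p q → Maybe (Holds σ λ ρ → ρ² ρ p ≢ ρ² ρ q)
    pairApart (b , c) (b′ , c′) =
      (do f ← apart σ b b′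
          just λ m e → f m (cong proj₁ e)) <∣>
      (do f ← apart σ c c′
          just λ m e → f m (cong proj₂ e))

  -- A path from `u` to `w` has one of nine middle pairs, and the pairs not excluded in the other
  -- embedding bound the multiplicity there. Only `L` must be free of repetitions: among the
  -- survivors they merely weaken the bound.
  scaffold-clash : ∀ σ e u w L → Maybe (Refuted σ)
  scaffold-clash σ e u w L = do
    a , b , c , N ← row σ u
    p , q , r , M ← row σ w
    u≢w ← apart σ u w
    facials ← allᴹ (λ { (b , c) → facialPath σ e u b c w }) L
    uniq ← distinctPairs σ L
    let candidates = cartesianProduct (a ∷ b ∷ c ∷ []) (p ∷ q ∷ r ∷ [])
        survivors = sift (notFacial σ (other e) u w) candidates
    few ← dec⇒maybe (length survivors <? length L)
    just λ {ρ} m →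
      let cover : ∀ {z} → FacialPath G (S (other e)) (ρ u) (proj₁ z) (proj₂ z) (ρ w) → z ∈ map (ρ² ρ) survivors
          cover h = locate m (λ y → ∈-row (N m) y) (λ y → ∈-row (M m) y) h
      in ⊥-elim (ℕ.<-irrefl refl (ℕ.<-≤-trans few
        (subst (_≤ _) (length-map (ρ² ρ) L) (subst (_ ≤_) (length-map (ρ² ρ) survivors)
          (facial-count-≤ (poly e) (same e) (u≢w m) (uniq m)
            (λ z∈ → All.lookup (All.map⁺ {f = ρ² ρ} (All.map (λ f → f m) facials)) z∈) cover)))))
    where
    ∈-row : ∀ {ρ v a b c y} → NbrsRow ρ (v , a , b , c) → Adj G (ρ v) y → ∃ λ i → i ∈ a ∷ b ∷ c ∷ [] × y ≡ ρ i
    ∈-row N vy with complete N _ vy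
    ... | inj₁ e = _ , here refl , e
    ... | inj₂ (inj₁ e) = _ , there (here refl) , e
    ... | inj₂ (inj₂ e) = _ , there (there (here refl)) , e
    locate : ∀ {ρ l l′} → Model ρ σ →
      (∀ {y} → Adj G (ρ u) y → ∃ λ i → i ∈ l × y ≡ ρ i) → (∀ {y} → Adj G (ρ w) y → ∃ λ i → i ∈ l′ × y ≡ ρ i) →
      ∀ {z} → FacialPath G (S (other e)) (ρ u) (proj₁ z) (proj₂ z) (ρ w) →
      z ∈ map (ρ² ρ) (sift (notFacial σ (other e) u w) (cartesianProduct l l′))
    locate {ρ} m N M {y , z} h@((_ , uy , _ , zw) , _) with N uy | M (Adj-sym G zw)
    ... | i , i∈ , refl | j , j∈ , refl
      with sift-complete (notFacial σ (other e) u w) (∈-cartesianProduct⁺ i∈ j∈)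
    ... | inj₁ ¬h = contradiction h (¬h m)
    ... | inj₂ s∈ = ∈-map⁺ (ρ² ρ) s∈

  data Link (σ : State) (s j : ℕ) : Set where
    absurd : Holds σ (λ ρ → ρ s ≢ ρ j) → Link σ s j
    child : ∀ σ′ → (∀ {ρ} → Model ρ σ → ρ s ≡ ρ j → ∃ λ ρ′ → Model ρ′ σ′) → Link σ s j

  -- If `s` is `j`, then `v` is a neighbour of `j`. When `j` has a row, `v` must be its one entry
  -- not known to differ from `v`, and `close` joins both loose ends. When only one neighbour of `j`
  -- is known, `v` becomes the second and `32 + j` names the third.
  link : ∀ σ v s a b → Holds σ (λ ρ → NbrsRow ρ (v , s , a , b)) → ∀ j → Maybe (Link σ s j)
  link σ v s a b N j with j ℕ.≟ v | j ℕ.≟ a | j ℕ.≟ b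
  ... | yes refl | _ | _ = just (absurd λ m e → Adj⇒≢ (adj₁ (N m)) (sym e))
  ... | _ | yes refl | _ = just (absurd λ m → 1≢2 (N m))
  ... | _ | _ | yes refl = just (absurd λ m → 1≢3 (N m))
  ... | no _ | no _ | no _ = maybe′ (assoc j (rows σ)) (assoc j (half σ))
    where
    jv : ∀ {ρ} → Model ρ σ → ρ s ≡ ρ j → Adj G (ρ j) (ρ v)
    jv {ρ} m e = subst (λ z → Adj G z (ρ v)) e (Adj-sym G (adj₁ (N m)))
    close : ∀ z → (∀ {ρ} → Model ρ σ → ρ s ≡ ρ j → ρ z ≡ ρ v) → Link σ s j
    close z h = child (rename z v (rename s j σ)) λ {ρ} m e → ρ , rename-model (h m e) (rename-model e m)
    full : ∀ {p q r} → Holds σ (λ ρ → NbrsRow ρ (j , p , q , r)) → Maybe (Link σ s j)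
    full {p} {q} {r} M with apart σ v p | apart σ v q | apart σ v r
    ... | just f | just g | just h = just (absurd λ m e → [ f m , [ g m , h m ]′ ]′ (complete (M m) _ (jv m e)))
    ... | nothing | just g | just h = just (close p λ m e →
      [ sym , [ (λ x → contradiction x (g m)) , (λ x → contradiction x (h m)) ]′ ]′ (complete (M m) _ (jv m e)))
    ... | just f | nothing | just h = just (close q λ m e →
      [ (λ x → contradiction x (f m)) , [ sym , (λ x → contradiction x (h m)) ]′ ]′ (complete (M m) _ (jv m e)))
    ... | just f | just g | nothing = just (close r λ m e →
      [ (λ x → contradiction x (f m)) , [ (λ x → contradiction x (g m)) , sym ]′ ]′ (complete (M m) _ (jv m e)))
    -- Several open entries would call for another split; the certificate avoids this case.
    ... | _ | _ | _ = nothing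
    extend : ∀ u → (j , u) ∈ half σ → Maybe (Link σ s j)
    extend u ju∈ = do
      u≢v ← apart σ u v
      new ← fresh σ (32 + j)
      j≢k ← distinct j (32 + j)
      u≢k ← distinct u (32 + j)
      v≢k ← distinct v (32 + j)
      s≢k ← distinct s (32 + j)
      just (child (rename s j (addRow (j , u , v , 32 + j) σ)) λ {ρ} m e →
        let z , M = third (All.lookup (half✓ m) ju∈) (jv m e) (u≢v m)
            o = λ {i} → update-other ρ {32 + j} z {i}
        in ρ [ 32 + j ↦ z ] , rename-model (trans (o s≢k) (trans e (sym (o j≢k))))
          (addRow-model (j , u , v , 32 + j) (new z m)
            (subst-Nbrs (sym (o j≢k)) (sym (o u≢k)) (sym (o v≢k)) (sym (update-same ρ (32 + j) z)) M)))
    maybe′ : Maybe _ → Maybe _ → Maybe (Link σ s j)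
    maybe′ (just (_ , r∈)) _ = full (λ m → All.lookup (rows✓ m) r∈)
    maybe′ nothing (just (u , ju∈)) = extend u ju∈
    maybe′ nothing nothing = nothing

  finished : ∀ σ → Maybe (Refuted σ)
  finished σ = do
    reals ← ∀Finᴹ (λ i → member (label i) (real σ))
    small ← ∀Finᴹ (λ i → dec⇒maybe (label i <? 32))
    nbs ← ∀Finᴹ nbr
    paths ← allᴹ (λ { (a , b , c , d) → facialPath σ A (label a) (label b) (label c) (label d) }) facial
    just λ {ρ} m →
      let V≡ : ∀ i → ρ (label i) ≡ V i
          V≡ i = base m (label i) (small i)
      in record
        { V-injective = λ i j e → label-injective i j (real✓ m (reals i) (reals j) (trans (V≡ i) (trans e (sym (V≡ j)))))
        ; V-nbrs = λ i → subst-Nbrs (V≡ i) (V≡ _) (V≡ _) (V≡ _) (nbs i m)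
        ; V-facial = All.map (λ { {a , b , c , d} h → subst-path (V≡ a) (V≡ b) (V≡ c) (V≡ d) (h m) }) paths }
    where
    nbr : ∀ i → Maybe (Holds σ λ ρ → Nbrs (ρ (label i)) (ρ (label (proj₁ (adjacent i))))
      (ρ (label (proj₁ (proj₂ (adjacent i))))) (ρ (label (proj₂ (proj₂ (adjacent i))))))
    nbr i with adjacent i
    ... | a , b , c = arrange σ (label i) (label a) (label b) >>= select
      where
      select : _ → _
      select (c′ , N) with label c ℕ.≟ c′
      ... | yes refl = just N
      ... | no _ = nothing
    subst-path : ∀ {e a a′ b b′ c c′ d d′} → a ≡ a′ → b ≡ b′ → c ≡ c′ → d ≡ d′ →
      FacialPath G (S e) a b c d → FacialPath G (S e) a′ b′ c′ d′
    subst-path refl refl refl refl h = h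

  check : Cert → (σ : State) → Maybe (Refuted σ)
  -- Certificates are consumed in the order of the explored vertices, one for each identification
  -- that is not absurd at sight; exactly one must remain, for `s` being a new vertex. The
  -- implication in the result accumulates the exclusions made so far, so that distinctness from the
  -- remaining `js` is enough.
  links : List Cert → ∀ σ v s a b → Holds σ (λ ρ → NbrsRow ρ (v , s , a , b)) → ∀ js →
    Maybe (∀ {ρ} → Model ρ σ → ((∀ {j} → j ∈ js → ρ s ≢ ρ j) → ∀ {j} → j ∈ real σ → ρ s ≢ ρ j) → Goal)

  check (edge e b c k l) σ = do
    a , a′ , N ← around σ b c
    d , d′ , M ← around σ c b
    r ← check k (addEq e (b , a) (c , d) (addEq e (b , a′) (c , d′) σ))
    r′ ← check l (addEq e (b , a) (c , d′) (addEq e (b , a′) (c , d) σ))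
    just λ m → [ (λ (p , q) → r (addEq-model e (addEq-model e m p) q))
               , (λ (p , q) → r′ (addEq-model e (addEq-model e m p) q)) ]′ (E.F-edge e (N m) (M m))
  check (stub v s ks) σ = do
    a , b , N ← around σ v s
    r ← links ks σ v s a b N (real σ)
    just λ m → r m id
  check (grow x k) σ = do
    v , xv∈ ← assoc x (half σ)
    let y = 48 + x
        z = 32 + x
    newʸ ← fresh σ y
    newᶻ ← fresh σ z
    x≢y ← distinct x y
    x≢z ← distinct x z
    v≢y ← distinct v y
    v≢z ← distinct v z
    y≢z ← distinct y z
    r ← check k (addRow (x , v , y , z) σ)
    just λ {ρ} m →
      let p , q , N = nbrs-from (All.lookup (half✓ m) xv∈)
          o = λ {i} (i≢y : i ≢ y) (i≢z : i ≢ z) →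
            trans (update-other (ρ [ y ↦ p ]) {z} q {i} i≢z) (update-other ρ {y} p {i} i≢y)
      in r (addRow-model (x , v , y , z) (newᶻ q (newʸ p m)) (subst-Nbrs (sym (o x≢y x≢z)) (sym (o v≢y v≢z))
        (sym (trans (update-other (ρ [ y ↦ p ]) q y≢z) (update-same ρ y p)))
        (sym (update-same (ρ [ y ↦ p ]) z q)) N))
  check (dup e v x y) σ = do
    _ , N ← arrange σ v x y
    q ← equal σ e (v , x) (v , y)
    just λ m → contradiction (q m) (E.F-injective e (adj₁ (N m)) (adj₂ (N m)) (1≢2 (N m)))
  check (adj e v w q) σ = do
    _ , _ , N ← around σ v w
    _ , _ , M ← around σ w q
    h ← equal σ e (v , w) (w , q)
    just λ m → contradiction (h m) (E.F-avoids-vertex e (adj₁ (N m)) (adj₁ (M m)))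
  check (two e v w x y p q) σ = do
    v≢w ← apart σ v w
    z , N ← arrange σ v x y
    _ , M ← arrange σ w p q
    g ← equal σ e (v , x) (w , p)
    h ← equal σ e (v , y) (w , q)
    -- Adjacency would make `w` one of `x`, `y`, `z`. If it were `x` or `y`, it would lie on a face
    -- that avoids it, so only `z` has to be told apart.
    w≢z ← apart σ w z
    just λ {ρ} m →
      let vw = E.shared-two⇒Adj e (v≢w m) (adj₁ (N m)) (adj₂ (N m)) (1≢2 (N m)) (adj₁ (M m)) (adj₂ (M m)) (g m) (h m)
          avoid = λ {q} (wq : Adj G (ρ w) (ρ q)) {x} (eq : FK e ρ (v , x) ≡ FK e ρ (w , q)) (w≡x : ρ w ≡ ρ x) →
            E.F-avoids-vertex e vw wq (trans (cong (E.F e (ρ v)) w≡x) eq)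
      in ⊥-elim ([ avoid {p} (adj₁ (M m)) {x} (g m) , [ avoid {q} (adj₂ (M m)) {y} (h m) , w≢z m ]′ ]′ (complete (N m) _ vw))
  check (scaf e u w L) σ = scaffold-clash σ e u w L
  check (forb e b c) σ = do
    h ← facialPath σ e 1 b c 4
    just λ {ρ} m → ⊥-elim (unscaffolded e (ρ b) (ρ c)
      (subst (λ z → FacialPath G (S e) z (ρ b) (ρ c) (ρ₀ 4)) (base m 1 (from-yes (1 <? 32)))
        (subst (FacialPath G (S e) (ρ 1) (ρ b) (ρ c)) (base m 4 (from-yes (4 <? 32))) (h m))))
  check done σ = finished σ

  links (k ∷ []) σ v s a b N [] = do
    r ← check k (addReal s v σ)
    just λ m new → r (addReal-model m (Adj-sym G (adj₁ (N m))) (new λ ()))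
  links _ σ v s a b N [] = nothing
  links ks σ v s a b N (j ∷ js) = link σ v s a b N j >>= λ
    { (absurd ne) → do
        r ← links ks σ v s a b N js
        just λ m new → r m λ f → new λ { (here refl) → ne m ; (there j∈) → f j∈ }
    ; (child σ′ h) → descend ks σ′ h }
    where
    descend : List Cert → ∀ σ′ → (∀ {ρ} → Model ρ σ → ρ s ≡ ρ j → ∃ λ ρ′ → Model ρ′ σ′) → Maybe _
    descend [] _ _ = nothing
    descend (k ∷ ks) σ′ h = do
      r ← check k σ′
      r′ ← links ks σ v s a b N js
      just λ {ρ} m new → step r (h m) (λ ne → r′ m λ f → new λ { (here refl) → ne ; (there j∈) → f j∈ }) (ρ s Fin.≟ ρ j)
      where
      step : ∀ {P : Set} → Refuted σ′ → (P → ∃ λ ρ′ → Model ρ′ σ′) → (¬ P → Goal) → Dec P → Goal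
      step r f g (yes p) = r (proj₂ (f p))
      step r f g (no ¬p) = g ¬p

-- The two equations say that t1 t2 t3 t4 is facial in A and t1 t2 t3 t4' in B.
initial : State
initial = state
  ((0 , 2 , 7 , 16) ∷ (1 , 2 , 8 , 17) ∷ (2 , 0 , 1 , 3) ∷ (3 , 2 , 4 , 19) ∷ (4 , 3 , 5 , 6) ∷
   (5 , 4 , 7 , 21) ∷ (6 , 4 , 8 , 22) ∷ (7 , 5 , 0 , 23) ∷ (8 , 6 , 1 , 24) ∷ [])
  (0 ∷ 1 ∷ 2 ∷ 3 ∷ 4 ∷ 5 ∷ 6 ∷ 7 ∷ 8 ∷ [])
  []
  (((3 , 19) , (4 , 6)) ∷ [])
  (((3 , 19) , (4 , 5)) ∷ [])

-- Found by computer search.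
certificate : Cert
certificate =
  edgeˢ A 2 3 (forb A 2 3) $
  edgeˢ B 2 3 (forb B 2 3) $
  edgeˢ A 3 4 (dup A 3 2 19) $
  edge B 3 4 (dup B 3 2 19) $
  edge A 6 8 (forb A 8 6) $
  edge B 6 8 (forb B 8 6) $
  edge A 0 2
    (edge A 5 7 (edge A 4 5 (adj A 0 7 23) $ edgeˢ A 0 7 (two A 4 0 3 6 2 7) $ two A 0 4 7 16 6 3) $
     edge A 4 5 (adj A 0 7 0) $
     edge A 0 7 (two A 0 5 7 16 7 4) $
     stub 0 16 (
       two A 0 5 2 7 4 7 ∷ two A 0 5 2 7 4 7 ∷
       (edge B 0 7 (edge B 0 5 (adj B 7 5 4) $ adj B 5 7 5) $
        edgeˢ B 0 5 (adj B 5 7 23) $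
        edge B 0 2 (adj B 4 5 7) $ edge B 4 5 (two B 0 4 7 5 3 5) $ two B 0 3 7 5 2 19) ∷
       two A 0 5 2 7 4 7 ∷ two A 0 5 2 7 4 7 ∷ two A 0 5 2 7 4 7 ∷ [])) $
  edgeˢ A 0 7 (edgeˢ A 4 5 (adj A 5 7 5) $ adj A 7 5 21) $
  edgeˢ A 4 5 (adj A 5 7 23) $
  edgeˢ A 5 7 (dup A 5 4 21) $
  stub 3 19 (
    adj A 0 3 0 ∷
    (edgeˢ A 1 3 (adj A 1 2 0) $
     edgeˢ A 1 8 (adj A 6 4 5) $ edge A 4 6 (dup A 8 6 1) $ two A 1 6 2 3 8 4) ∷
    adj A 3 5 3 ∷ (edge B 3 6 (adj B 4 6 4) $ adj B 4 6 8) ∷ adj A 3 7 3 ∷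
    (edge B 3 8 (forb B 8 3) $ adj B 4 6 22) ∷
    stub 5 21 (
      adj A 0 5 0 ∷ scaf A 2 5 ((0 , 7) ∷ (3 , 4) ∷ []) ∷
      (edgeˢ A 4 6 (adj A 6 5 7) $
       edgeˢ A 5 6 (dup A 5 4 7) $
       stub 1 17 (
         scaf A 2 5 ((0 , 7) ∷ (3 , 4) ∷ []) ∷
         (edge A 1 8 (adj A 1 7 0) $
          edgeˢ A 1 2 (two A 3 8 2 4 1 6) $ edge A 1 7 (dup A 1 2 8) $ adj A 0 2 0) ∷
         scaf A 2 5 ((0 , 7) ∷ (3 , 4) ∷ []) ∷ scaf A 2 5 ((0 , 7) ∷ (3 , 4) ∷ []) ∷ [])) ∷
      (edgeˢ A 5 8 (forb A 8 5) $
       edge A 4 6 (dup A 4 3 5) $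
       edgeˢ B 5 8 (forb B 8 5) $
       edgeˢ B 4 5 (adj B 4 6 22) $
       edge B 4 6 (dup B 4 3 5) $
       stub 7 23 (
         (edgeˢ A 1 8 (adj A 1 7 0) $
          edgeˢ B 1 8 (scaf A 5 7 ((8 , 1) ∷ [])) $ edge B 1 2 (two B 2 6 1 3 8 4) $ two B 2 6 0 1 4 8) ∷
         (edgeˢ B 0 7 (scaf A 2 5 ((0 , 7) ∷ (3 , 4) ∷ [])) $
          edgeˢ B 0 2 (adj B 7 6 8) $ edge B 5 7 (two B 0 3 7 16 19 2) $ scaf A 6 8 ((4 , 5) ∷ (7 , 5) ∷ [])) ∷
         stub 19 51 (
           scaf B 5 19 ((4 , 3) ∷ []) ∷
           (edge B 3 19 (forb B 19 3) $ edge B 5 7 (adj B 7 19 1) $ scaf A 8 19 ((5 , 7) ∷ [])) ∷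
           scaf A 6 19 ((4 , 3) ∷ []) ∷ scaf B 5 19 ((4 , 3) ∷ []) ∷ []) ∷
         (edgeˢ A 1 8 (scaf A 2 5 ((0 , 7) ∷ (1 , 8) ∷ (3 , 4) ∷ [])) $
          edgeˢ A 1 2 (two A 3 6 2 4 8 4) $
          edge B 1 8 (scaf A 2 5 ((0 , 7) ∷ (3 , 4) ∷ [])) $
          edgeˢ B 1 2 (two B 3 5 2 4 8 4) $
          edgeˢ B 0 2 (edge B 5 7 (adj B 0 7 0) $ adj B 0 7 23) $
          edge B 5 7 (adj B 7 0 16) $
          grow 19 $
          stub 19 51 (
            (edgeˢ B 0 19 (adj B 3 19 3) $ adj B 3 19 67) ∷
            (edgeˢ A 1 19 (adj A 19 3 4) $
             stub 19 67 (
               scaf A 1 19 ((2 , 3) ∷ (2 , 0) ∷ []) ∷ scaf A 3 7 ((2 , 0) ∷ (4 , 5) ∷ []) ∷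
               (edgeˢ A 7 23 (adj A 23 19 3) $
                edge A 19 23 (dup A 19 3 1) $
                stub 0 16 (
                  scaf A 0 4 ((2 , 3) ∷ (7 , 5) ∷ []) ∷ scaf A 0 4 ((2 , 3) ∷ (7 , 5) ∷ []) ∷
                  stub 6 22 (
                    scaf A 0 4 ((2 , 3) ∷ (7 , 5) ∷ []) ∷
                    (edge A 6 16 (adj A 16 0 7) $
                     stub 23 55 (
                       (edge A 23 16 done $ two A 0 3 2 16 2 19) ∷ scaf A 8 23 ((1 , 19) ∷ (5 , 7) ∷ []) ∷ [])) ∷
                    scaf A 0 4 ((2 , 3) ∷ (7 , 5) ∷ []) ∷ []) ∷ [])) ∷
               scaf A 3 7 ((2 , 0) ∷ (4 , 5) ∷ []) ∷ [])) ∷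
            (edgeˢ A 3 19 (adj A 19 6 8) $ edgeˢ A 6 19 (dup A 6 4 8) $ two A 1 19 8 17 6 3) ∷
            stub 0 16 (
              adj A 1 0 7 ∷ scaf A 0 4 ((2 , 3) ∷ (7 , 5) ∷ []) ∷
              scaf B 0 8 ((2 , 1) ∷ (7 , 5) ∷ []) ∷ scaf A 0 4 ((2 , 3) ∷ (7 , 5) ∷ []) ∷
              (edge A 19 23 (scaf A 3 7 ((2 , 0) ∷ (4 , 5) ∷ (19 , 23) ∷ [])) $
               stub 6 22 (
                 adj A 1 6 4 ∷ scaf A 0 4 ((2 , 3) ∷ (7 , 5) ∷ []) ∷
                 scaf A 0 4 ((2 , 3) ∷ (7 , 5) ∷ []) ∷
                 (edgeˢ A 0 16 (adj A 16 6 4) $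
                  edge A 6 16 (dup A 6 4 8) $
                  edgeˢ A 3 19
                    (edge A 7 23 (two A 19 1 3 67 2 8) $
                     stub 1 17 (
                       two A 1 23 2 8 19 7 ∷ scaf A 5 23 ((8 , 1) ∷ []) ∷ two A 1 23 2 8 19 7 ∷
                       two A 1 23 2 8 19 7 ∷ [])) $
                  edgeˢ A 7 23 (two A 19 16 3 67 6 0) $
                  stub 1 17 (
                    stub 23 55 (
                      done ∷ two A 23 16 7 19 0 6 ∷ []) ∷
                    two A 1 19 2 8 3 23 ∷ two A 1 19 2 8 3 23 ∷ two A 1 19 2 8 3 23 ∷ [])) ∷
                 scaf A 0 4 ((2 , 3) ∷ (7 , 5) ∷ []) ∷ [])) ∷ []) ∷
            stub 19 67 (
              scaf B 0 8 ((2 , 1) ∷ (7 , 5) ∷ []) ∷ scaf A 3 7 ((2 , 0) ∷ (4 , 5) ∷ []) ∷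
              scaf A 3 7 ((2 , 0) ∷ (4 , 5) ∷ []) ∷
              (edge B 7 23 (scaf B 5 19 ((4 , 3) ∷ (7 , 23) ∷ [])) $
               edge B 3 19 (adj B 19 23 19) $ adj B 23 19 51) ∷
              scaf A 3 7 ((2 , 0) ∷ (4 , 5) ∷ []) ∷ []) ∷ [])) ∷ [])) ∷
      stub 19 51 (
        scaf B 5 19 ((4 , 3) ∷ []) ∷ scaf B 5 19 ((4 , 3) ∷ []) ∷
        scaf A 6 19 ((4 , 3) ∷ (4 , 5) ∷ []) ∷ scaf B 5 19 ((4 , 3) ∷ []) ∷
        scaf B 5 19 ((4 , 3) ∷ []) ∷
        (edgeˢ B 4 5 (scaf B 3 19 ((4 , 5) ∷ [])) $ edge B 3 19 (adj B 5 19 5) $ adj B 5 19 51) ∷ []) ∷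
      stub 1 17 (
        scaf A 2 5 ((0 , 7) ∷ (3 , 4) ∷ []) ∷
        (edgeˢ B 1 6 (adj B 1 8 24) $
         edgeˢ B 4 6 (adj B 2 1 8) $ edge B 1 2 (two B 2 4 0 1 3 5) $ two B 2 4 1 3 5 3) ∷
        (edgeˢ B 5 7 (forb B 7 5) $
         edgeˢ B 0 2
           (edge B 0 7 (adj B 4 5 21) $
            edgeˢ A 1 7 (edge A 1 2 (adj A 0 2 0) $ dup A 0 2 7) $
            scaf A 2 5 ((0 , 7) ∷ (1 , 7) ∷ (3 , 4) ∷ [])) $
         stub 0 16 (
           scaf A 1 6 ((2 , 0) ∷ (7 , 0) ∷ []) ∷ scaf A 1 8 ((2 , 0) ∷ (7 , 0) ∷ []) ∷
           scaf B 1 7 ((2 , 0) ∷ []) ∷ scaf B 1 7 ((2 , 0) ∷ []) ∷ scaf B 1 7 ((2 , 0) ∷ []) ∷ [])) ∷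
        stub 0 16 (
          scaf A 2 5 ((0 , 7) ∷ (3 , 4) ∷ []) ∷ scaf A 2 5 ((0 , 7) ∷ (3 , 4) ∷ []) ∷
          scaf A 2 5 ((0 , 7) ∷ (3 , 4) ∷ []) ∷
          (edge A 0 21 (scaf A 2 5 ((0 , 7) ∷ (0 , 21) ∷ (3 , 4) ∷ [])) $
           edgeˢ A 5 21 (dup A 7 5 0) $ two A 0 4 2 21 3 6) ∷
          scaf A 2 5 ((0 , 7) ∷ (3 , 4) ∷ []) ∷ []) ∷
        (edge A 5 21 (forb A 21 5) $
         edge B 5 21 (forb B 21 5) $
         stub 21 53 (
           (edge A 0 21 (two A 0 4 7 21 3 6) $ two A 0 4 2 21 3 6) ∷
           (edgeˢ A 1 21 (edgeˢ A 6 21 (adj A 6 4 3) $ adj A 1 8 24) $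
            scaf A 2 5 ((0 , 7) ∷ (1 , 21) ∷ (3 , 4) ∷ [])) ∷
           adj A 21 7 0 ∷
           (edgeˢ A 1 21 (edge A 1 8 (adj A 21 8 6) $ adj A 8 21 8) $
            scaf A 2 5 ((0 , 7) ∷ (1 , 21) ∷ (3 , 4) ∷ [])) ∷
           (edge A 1 21 (scaf A 2 5 ((0 , 7) ∷ (1 , 21) ∷ (3 , 4) ∷ [])) $
            edgeˢ B 1 21 (scaf A 2 5 ((0 , 7) ∷ (3 , 4) ∷ [])) $
            stub 19 51 (
              scaf A 2 19 ((1 , 21) ∷ []) ∷ scaf A 2 19 ((1 , 21) ∷ []) ∷ scaf B 5 19 ((4 , 3) ∷ []) ∷
              scaf B 5 19 ((4 , 3) ∷ []) ∷
              stub 0 16 (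
                scaf A 2 19 ((1 , 21) ∷ []) ∷ scaf A 2 19 ((1 , 21) ∷ []) ∷
                stub 6 22 (
                  scaf B 5 19 ((4 , 3) ∷ []) ∷ scaf A 6 19 ((4 , 3) ∷ []) ∷
                  (edgeˢ A 1 8 (scaf B 2 6 ((3 , 4) ∷ [])) $
                   edge B 1 8 (scaf B 2 6 ((1 , 8) ∷ (3 , 4) ∷ [])) $
                   edge B 4 5 (scaf B 6 21 ((4 , 5) ∷ (8 , 1) ∷ [])) $
                   edgeˢ A 1 2 (scaf B 3 21 ((4 , 5) ∷ [])) $
                   edgeˢ A 3 19 (adj A 19 21 5) $ edge B 3 19 (adj B 19 21 1) $ scaf A 2 21 ((3 , 19) ∷ [])) ∷ []) ∷
                scaf A 2 19 ((1 , 21) ∷ []) ∷ []) ∷ [])) ∷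
           (edgeˢ B 0 7 (scaf A 2 5 ((0 , 7) ∷ (3 , 4) ∷ [])) $
            edge A 1 21 (scaf A 2 5 ((0 , 7) ∷ (1 , 21) ∷ (3 , 4) ∷ [])) $
            edgeˢ B 1 21 (scaf A 2 5 ((0 , 7) ∷ (3 , 4) ∷ [])) $
            edgeˢ A 1 8 (edge A 4 6 (two A 5 6 4 7 4 8) $ two A 5 6 4 7 4 22) $
            edgeˢ A 4 6 (two A 5 8 4 7 6 1) $
            edgeˢ A 1 2 (two A 3 6 2 4 22 4) $
            edge B 5 7 (edgeˢ B 0 2 (adj B 4 5 21) $ edgeˢ B 1 2 (dup B 5 4 21) $ two B 1 5 8 21 4 21) $
            edgeˢ B 0 2 (adj B 2 1 8) $
            stub 0 16 (
              scaf A 0 4 ((2 , 3) ∷ (7 , 5) ∷ []) ∷ adj A 8 0 7 ∷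
              (edgeˢ B 0 19 (adj B 3 19 3) $ adj B 3 19 51) ∷ scaf B 0 21 ((2 , 1) ∷ (7 , 5) ∷ []) ∷
              stub 7 23 (
                scaf B 0 21 ((2 , 1) ∷ (7 , 5) ∷ []) ∷ scaf A 3 7 ((2 , 0) ∷ (4 , 5) ∷ []) ∷
                scaf A 3 7 ((2 , 0) ∷ (4 , 5) ∷ []) ∷ (edge A 7 53 (adj A 21 53 85) $ adj A 21 53 21) ∷
                scaf B 0 21 ((2 , 1) ∷ (7 , 5) ∷ []) ∷ scaf B 0 21 ((2 , 1) ∷ (7 , 5) ∷ []) ∷ []) ∷ [])) ∷ [])) ∷
        stub 0 16 (
          scaf A 2 5 ((0 , 7) ∷ (3 , 4) ∷ []) ∷ scaf A 2 5 ((0 , 7) ∷ (3 , 4) ∷ []) ∷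
          scaf A 2 5 ((0 , 7) ∷ (3 , 4) ∷ []) ∷
          (edge A 0 21 (scaf A 2 5 ((0 , 7) ∷ (0 , 21) ∷ (3 , 4) ∷ [])) $
           edgeˢ A 5 21 (dup A 7 5 0) $ two A 0 4 2 21 3 6) ∷
          scaf A 2 5 ((0 , 7) ∷ (3 , 4) ∷ []) ∷ scaf A 2 5 ((0 , 7) ∷ (3 , 4) ∷ []) ∷ []) ∷ []) ∷ []) ∷ [])

-- The Franklin graph as the target of the search

windows : ∀ {X : Set} → List X → List (X × X × X × X)
-- Repeating the first three entries makes the windows wrap around, one for each starting vertex.
windows (a ∷ b ∷ c ∷ xs) = go (a ∷ b ∷ c ∷ xs ++ a ∷ b ∷ c ∷ [])
  where
  go : List _ → List _
  go (a ∷ xs@(b ∷ c ∷ d ∷ _)) = (a , b , c , d) ∷ go xs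
  go _ = []
windows _ = []

-- The Hamiltonian cycle `t0 t1 t0' t5' t4 t5 x5 x2 t2 t3 t4' x0`, matched with the 12-cycle of
-- `franklinEdges`.
franklinLabels : Vec ℕ 12
franklinLabels = 0 ∷ 2 ∷ 1 ∷ 8 ∷ 5 ∷ 7 ∷ 23 ∷ 19 ∷ 3 ∷ 4 ∷ 6 ∷ 16 ∷ []

franklinNbrs : Vec (Fin 12 × Fin 12 × Fin 12) 12
franklinNbrs =
  (# 1 , # 5 , # 11) ∷ (# 0 , # 2 , # 8) ∷ (# 1 , # 3 , # 7) ∷
  (# 2 , # 4 , # 10) ∷ (# 3 , # 5 , # 9) ∷ (# 4 , # 6 , # 0) ∷
  (# 5 , # 7 , # 11) ∷ (# 6 , # 8 , # 2) ∷ (# 7 , # 9 , # 1) ∷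
  (# 8 , # 10 , # 4) ∷ (# 9 , # 11 , # 3) ∷ (# 10 , # 0 , # 6) ∷ []

-- The embedding A, in the projective plane.
franklinFaces : List (List (Fin 12))
franklinFaces =
  (# 0 ∷ # 5 ∷ # 6 ∷ # 11 ∷ []) ∷
  (# 2 ∷ # 1 ∷ # 8 ∷ # 7 ∷ []) ∷
  (# 9 ∷ # 4 ∷ # 3 ∷ # 10 ∷ []) ∷
  (# 0 ∷ # 1 ∷ # 2 ∷ # 3 ∷ # 10 ∷ # 11 ∷ []) ∷
  (# 0 ∷ # 1 ∷ # 8 ∷ # 9 ∷ # 4 ∷ # 5 ∷ []) ∷
  (# 2 ∷ # 3 ∷ # 4 ∷ # 5 ∷ # 6 ∷ # 7 ∷ []) ∷
  (# 8 ∷ # 9 ∷ # 10 ∷ # 11 ∷ # 6 ∷ # 7 ∷ []) ∷ []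

franklin : Target
franklin = record
  { size = 12
  ; label = lookup franklinLabels
  ; label-injective = from-yes (all? λ i → all? λ j → (lookup franklinLabels i ℕ.≟ lookup franklinLabels j) →-dec (i Fin.≟ j))
  ; adjacent = lookup franklinNbrs
  ; facial = concatMap windows franklinFaces
  }

-- The embedded Franklin graph

Vertex : Set
Vertex = Fin 12

Path : Set
Path = Vertex × Vertex × Vertex × Vertex

nbrList : Vertex → List Vertex
nbrList i with a , b , c ← lookup franklinNbrs i = a ∷ b ∷ c ∷ []

_≟ᴾ_ : (p q : Path) → Dec (p ≡ q)
_≟ᴾ_ = ≡-dec Fin._≟_ (≡-dec Fin._≟_ (≡-dec Fin._≟_ Fin._≟_))

open import Data.List.Membership.DecPropositional ℕ._≟_ using () renaming (_∈?_ to _∈ᴸ?_)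
open import Data.List.Membership.DecPropositional _≟ᴾ_ using () renaming (_∈?_ to _∈ᴾ?_)
open import Data.List.Membership.DecPropositional (≡-dec (Fin._≟_ {12}) (Fin._≟_ {12})) using ()
  renaming (_∈?_ to _∈²?_)
open import Data.List.Membership.DecPropositional (≡-dec ℕ._≟_ ℕ._≟_) using () renaming (_∈?_ to
  _∈ᴺ?_)
open import Data.List.Membership.DecPropositional (Fin._≟_ {12}) using () renaming (_∈?_ to _∈ⱽ?_)
open import Data.List.Relation.Unary.Unique.DecPropositional (≡-dec (Fin._≟_ {12}) (Fin._≟_ {12}))
  using (unique?)

reversePath : Path → Path
reversePath (a , b , c , d) = d , c , b , a

between : Vertex → Vertex → List Path → List (Vertex × Vertex)
between i j [] = []
between i j ((a , b , c , d) ∷ ps) with i Fin.≟ a | j Fin.≟ d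
... | yes _ | yes _ = (b , c) ∷ between i j ps
... | _ | _ = between i j ps

∈-between⁻ : ∀ {i j b c} ps → (b , c) ∈ between i j ps → (i , b , c , j) ∈ ps
∈-between⁻ {i} {j} ((a , b , c , d) ∷ ps) h with i Fin.≟ a | j Fin.≟ d
∈-between⁻ (_ ∷ ps) (here refl) | yes refl | yes refl = here refl
∈-between⁻ (_ ∷ ps) (there h) | yes refl | yes refl = there (∈-between⁻ ps h)
∈-between⁻ (_ ∷ ps) h | yes _ | no _ = there (∈-between⁻ ps h)
∈-between⁻ (_ ∷ ps) h | no _ | _ = there (∈-between⁻ ps h)

∈-between⁺ : ∀ {i j b c} {ps} → (i , b , c , j) ∈ ps → (b , c) ∈ between i j ps
∈-between⁺ {i} {j} {ps = (a , b , c , d) ∷ ps} h with i Fin.≟ a | j Fin.≟ d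
∈-between⁺ (here refl) | yes refl | yes refl = here refl
∈-between⁺ (there h) | yes refl | yes refl = there (∈-between⁺ h)
∈-between⁺ (here refl) | yes _ | no j≢j = contradiction refl j≢j
∈-between⁺ (there h) | yes _ | no _ = ∈-between⁺ h
∈-between⁺ (here refl) | no i≢i | _ = contradiction refl i≢i
∈-between⁺ (there h) | no _ | _ = ∈-between⁺ h

InPairs? : ∀ ps (i j : Vertex) → Dec (InPairs ps i j)
InPairs? ps i j = ((i , j) ∈²? ps) ⊎-dec ((j , i) ∈²? ps)

FranklinAdj? : ∀ i j → Dec (FranklinAdj i j)
FranklinAdj? i j = ((toℕ i , toℕ j) ∈ᴺ? franklinEdges) ⊎-dec ((toℕ j , toℕ i) ∈ᴺ? franklinEdges)

-- The singles are the sides of the three quadrilateral faces, the doubles the opposite pairs on the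
-- four hexagons. Order and orientation are those of the theorem, so that mapping back through
-- `franklinLabels` yields its lists by computation.
singles doubles : List (Vertex × Vertex)
singles = (# 0 , # 5) ∷ (# 5 , # 6) ∷ (# 6 , # 11) ∷ (# 11 , # 0) ∷
          (# 1 , # 8) ∷ (# 8 , # 7) ∷ (# 7 , # 2) ∷ (# 2 , # 1) ∷
          (# 9 , # 10) ∷ (# 10 , # 3) ∷ (# 3 , # 4) ∷ (# 4 , # 9) ∷ []
doubles = (# 0 , # 9) ∷ (# 11 , # 8) ∷ (# 1 , # 10) ∷ (# 2 , # 5) ∷
          (# 4 , # 7) ∷ (# 6 , # 3) ∷ (# 0 , # 3) ∷ (# 1 , # 4) ∷
          (# 8 , # 5) ∷ (# 9 , # 6) ∷ (# 10 , # 7) ∷ (# 11 , # 2) ∷ []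

-- Kept abstract: with variable end points, unfolding the search through the 72 paths explodes.
abstract
  facialPaths : List Path
  facialPaths = Target.facial franklin ++ map reversePath (Target.facial franklin)

  ∈-facialPaths⁻ : ∀ {p} → p ∈ facialPaths →
    p ∈ Target.facial franklin ⊎ p ∈ map reversePath (Target.facial franklin)
  ∈-facialPaths⁻ = ∈-++⁻ (Target.facial franklin)

  mids : Vertex → Vertex → List (Vertex × Vertex)
  mids i j = between i j facialPaths

  ∈-mids⁻ : ∀ {i j b c} → (b , c) ∈ mids i j → (i , b , c , j) ∈ facialPaths
  ∈-mids⁻ = ∈-between⁻ facialPaths

  ∈-mids⁺ : ∀ {i j b c} → (i , b , c , j) ∈ facialPaths → (b , c) ∈ mids i j
  ∈-mids⁺ = ∈-between⁺

  nbrs⇒FranklinAdj : ∀ i → All (FranklinAdj i) (nbrList i)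
  nbrs⇒FranklinAdj = from-yes (all? λ i → All.all? (FranklinAdj? i) (nbrList i))

  FranklinAdj⇒nbrs : ∀ i j → FranklinAdj i j → j ∈ nbrList i
  FranklinAdj⇒nbrs = from-yes (all? λ i → all? λ j → FranklinAdj? i j →-dec (j ∈ⱽ? nbrList i))

  mids-unique : ∀ i j → Unique (mids i j)
  mids-unique = from-yes (all? λ i → all? λ j → unique? (mids i j))

  -- Every path i b c that does not turn back is extended by some facial path, so a path
  -- that is not listed is excluded by a listed one.
  facialPaths-decide : ∀ i → All (λ b → All (λ c → i ≡ c ⊎ All (λ j →
    (i , b , c , j) ∈ facialPaths ⊎ Any (λ d → d ≢ j × (i , b , c , d) ∈ facialPaths) (nbrList c))
    (nbrList c)) (nbrList b)) (nbrList i)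
  facialPaths-decide = from-yes (all? λ i → All.all? (λ b → All.all? (λ c → (i Fin.≟ c) ⊎-dec All.all? (λ j →
    ((i , b , c , j) ∈ᴾ? facialPaths) ⊎-dec any? (λ d → ¬? (d Fin.≟ j) ×-dec ((i , b , c , d) ∈ᴾ? facialPaths)) (nbrList c))
    (nbrList c)) (nbrList b)) (nbrList i))

  singles-count : ∀ i j → InPairs singles i j → length (mids i j) ≡ 1
  singles-count = from-yes (all? λ i → all? λ j → InPairs? singles i j →-dec (length (mids i j) ℕ.≟ 1))

  doubles-count : ∀ i j → InPairs doubles i j → length (mids i j) ≡ 2
  doubles-count = from-yes (all? λ i → all? λ j → InPairs? doubles i j →-dec (length (mids i j) ℕ.≟ 2))

  others-count : ∀ i j → (i ≡ j ⊎ InPairs singles i j ⊎ InPairs doubles i j) ⊎ length (mids i j) ≡ 0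
  others-count = from-yes (all? λ i → all? λ j →
    ((i Fin.≟ j) ⊎-dec (InPairs? singles i j ⊎-dec InPairs? doubles i j)) ⊎-dec (length (mids i j) ℕ.≟ 0))

module _ {n} (G : Graph n) (cubic : Cubic G) where
  open CubicGraph G cubic

  FacialPath-reverse : ∀ {Π a b c d} → FacialPath G Π a b c d → FacialPath G Π d c b a
  FacialPath-reverse ((((a≢b ∷ a≢c ∷ a≢d ∷ []) ∷ (b≢c ∷ b≢d ∷ []) ∷ (c≢d ∷ []) ∷ _) , ab , bc , cd) , j , h) =
    (((≢-sym c≢d ∷ ≢-sym b≢d ∷ ≢-sym a≢d ∷ []) ∷ (≢-sym b≢c ∷ ≢-sym a≢c ∷ []) ∷ (≢-sym a≢b ∷ []) ∷ [] ∷ []) ,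
     Adj-sym G cd , Adj-sym G bc , Adj-sym G ab) , j , Sum.swap h

  -- `Π′` is the embedding A, possibly different from `Π`; only its multiplicities are carried over
  -- to `Π`.
  record FranklinEmbedding (Π : FaceSystem n) (V : Vertex → Fin n) : Set where
    field
      Π′ : FaceSystem n
      poly′ : IsPolyhedral G Π′
      same′ : SameExtended G Π Π′
      V-injective : ∀ i j → V i ≡ V j → i ≡ j
      V-nbrs : ∀ i → Nbrs (V i) (V (proj₁ (lookup franklinNbrs i)))
        (V (proj₁ (proj₂ (lookup franklinNbrs i)))) (V (proj₂ (proj₂ (lookup franklinNbrs i))))
      V-facial : All (λ (a , b , c , d) → FacialPath G Π′ (V a) (V b) (V c) (V d)) (Target.facial franklin)

  module FranklinMultiplicities {Π V} (E : FranklinEmbedding Π V) where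
    open FranklinEmbedding E
    open Polyhedral Π′ poly′

    V-complete : ∀ i {y} → Adj G (V i) y → ∃ λ j → j ∈ nbrList i × y ≡ V j
    V-complete i iy with complete (V-nbrs i) _ iy
    ... | inj₁ e = _ , here refl , e
    ... | inj₂ (inj₁ e) = _ , there (here refl) , e
    ... | inj₂ (inj₂ e) = _ , there (there (here refl)) , e

    Facialⱽ : Path → Set
    Facialⱽ (a , b , c , d) = FacialPath G Π′ (V a) (V b) (V c) (V d)

    listed : ∀ {p} → p ∈ facialPaths → Facialⱽ p
    listed p∈ with ∈-facialPaths⁻ p∈
    ... | inj₁ h = All.lookup V-facial h
    ... | inj₂ h with q , q∈ , refl ← ∈-map⁻ reversePath h = FacialPath-reverse {Π′} (All.lookup V-facial q∈)

    cover : ∀ {i j y z} → FacialPath G Π′ (V i) y z (V j) → ∃₂ λ b c → (b , c) ∈ mids i j × y ≡ V b × z ≡ V c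
    cover {i} {j} h@(path@(((_ ∷ i≢c ∷ _) ∷ _) , iy , yz , zj) , sub)
      with b , b∈ , refl ← V-complete i iy
      with c , c∈ , refl ← V-complete b yz
      with j′ , j∈ , e ← V-complete c zj
      with refl ← V-injective j j′ e
      with All.lookup (All.lookup (facialPaths-decide i) b∈) c∈
    ... | inj₁ refl = contradiction refl i≢c
    ... | inj₂ decide with All.lookup decide j∈
    ... | inj₁ p∈ = b , c , ∈-mids⁺ p∈ , refl , refl
    ... | inj₂ other with d , _ , d≢j , p∈ ← find other =
      ⊥-elim (FacialSub-exclusive path (proj₁ (listed p∈)) (λ e → d≢j (sym (V-injective j d e))) sub (proj₂ (listed p∈)))

    V² : Vertex × Vertex → Fin n × Fin n
    V² (b , c) = V b , V c

    V²-injective : ∀ {p q} → V² p ≡ V² q → p ≡ q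
    V²-injective e = cong₂ _,_ (V-injective _ _ (cong proj₁ e)) (V-injective _ _ (cong proj₂ e))

    mult′ : ∀ i j → Mult G Π′ (V i) (V j) (length (mids i j))
    mult′ i j = map V² (mids i j) , map⁺ V²-injective (mids-unique i j) , length-map V² (mids i j) , λ p → mk⇔ to from
      where
      to : ∀ {p} → p ∈ map V² (mids i j) → FacialPath G Π′ (V i) (proj₁ p) (proj₂ p) (V j)
      to p∈ with (b , c) , q∈ , refl ← ∈-map⁻ V² p∈ = listed (∈-mids⁻ q∈)
      from : ∀ {p} → FacialPath G Π′ (V i) (proj₁ p) (proj₂ p) (V j) → p ∈ map V² (mids i j)
      from h with _ , _ , q∈ , refl , refl ← cover h = ∈-map⁺ V² q∈

    mult : ∀ i j → i ≢ j → Mult G Π (V i) (V j) (length (mids i j))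
    mult i j i≢j = Equivalence.from (same′ (V i) (V j) _ (i≢j ∘ V-injective i j)) (mult′ i j)

  module FranklinConclusion (connected : Connected G) (Π : FaceSystem n) (poly : IsPolyhedral G Π)
    (V : Vertex → Fin n) (¬¬E : ¬ ¬ FranklinEmbedding Π V) where

    open Counting G cubic

    stable : ∀ {P : Set} → Dec P → (FranklinEmbedding Π V → P) → P
    stable P? f = decidable-stable P? λ ¬p → ¬¬E (¬p ∘ f)

    V-injective : ∀ i j → V i ≡ V j → i ≡ j
    V-injective i j e = stable (i Fin.≟ j) λ E → FranklinEmbedding.V-injective E i j e

    V-adj : ∀ i → All (λ j → Adj G (V i) (V j)) (nbrList i)
    V-adj i = stable (Adj? _ _) (λ E → adj₁ (FranklinEmbedding.V-nbrs E i)) ∷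
      stable (Adj? _ _) (λ E → adj₂ (FranklinEmbedding.V-nbrs E i)) ∷
      stable (Adj? _ _) (λ E → adj₃ (FranklinEmbedding.V-nbrs E i)) ∷ []

    -- The witness cannot be taken from under a double negation. It is found by testing equality
    -- with the three listed neighbours, and the embedding only refutes the failure of all three
    -- tests.
    V-complete : ∀ i {y} → Adj G (V i) y → ∃ λ j → j ∈ nbrList i × y ≡ V j
    V-complete i {y} iy with lookup franklinNbrs i in eq
    ... | a , b , c with y Fin.≟ V a | y Fin.≟ V b | y Fin.≟ V c
    ... | yes e | _ | _ = a , here refl , e
    ... | _ | yes e | _ = b , there (here refl) , e
    ... | _ | _ | yes e = c , there (there (here refl)) , e
    ... | no ¬a | no ¬b | no ¬c = ⊥-elim (¬¬E (no-case ∘ λ E →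
      complete (subst (λ (a , b , c) → Nbrs (V i) (V a) (V b) (V c)) eq (FranklinEmbedding.V-nbrs E i)) y iy))
      where
      no-case : ¬ (y ≡ V a ⊎ y ≡ V b ⊎ y ≡ V c)
      no-case (inj₁ e) = ¬a e
      no-case (inj₂ (inj₁ e)) = ¬b e
      no-case (inj₂ (inj₂ e)) = ¬c e

    -- The image of `V` is closed under adjacency, since its vertices have all three neighbours in
    -- it; connectedness does the rest.
    V-surjective : ∀ v → ∃ λ i → V i ≡ v
    V-surjective v = walk (connected (V (# 0)) v) (# 0 , refl)
      where
      walk : ∀ {u w} → Star (Adj G) u w → (∃ λ i → V i ≡ u) → ∃ λ i → V i ≡ w
      walk ε h = h
      walk (e ◅ es) (i , refl) with j , _ , refl ← V-complete i e = walk es (j , refl)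

    index : Fin n → Vertex
    index v = proj₁ (V-surjective v)

    V-index : ∀ v → V (index v) ≡ v
    V-index v = proj₂ (V-surjective v)

    Adj⇔FranklinAdj : ∀ i j → Adj G (V i) (V j) ⇔ FranklinAdj i j
    Adj⇔FranklinAdj i j = mk⇔ to (λ f → All.lookup (V-adj i) (FranklinAdj⇒nbrs i j f))
      where
      to : Adj G (V i) (V j) → FranklinAdj i j
      to e with k , k∈ , q ← V-complete i e with refl ← V-injective j k q = All.lookup (nbrs⇒FranklinAdj i) k∈

    isoToFranklin : IsoToFranklin G
    isoToFranklin = index ,
      ( (λ {u} {w} e → trans (sym (V-index u)) (trans (cong V e) (V-index w)))
      , (λ i → V i , λ { refl → V-injective _ _ (V-index (V i)) })) ,
      λ u w → subst₂ (λ x y → Adj G x y ⇔ FranklinAdj (index u) (index w)) (V-index u) (V-index w)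
        (Adj⇔FranklinAdj (index u) (index w))

    -- Counting in `Π` yields some multiplicity `k`, so only an equation between numbers has to pass
    -- through the double negation.
    mult : ∀ i j → i ≢ j → Mult G Π (V i) (V j) (length (mids i j))
    mult i j i≢j with k , m ← multiplicity Π poly (V i) (V j) =
      subst (Mult G Π (V i) (V j)) (stable (k ℕ.≟ _) λ E → Mult-functional G Π m (FranklinMultiplicities.mult E i j i≢j)) m

    V² : Vertex × Vertex → Fin n × Fin n
    V² (i , j) = V i , V j

    InPairs⁻ : ∀ ps {i j} → InPairs (map V² ps) (V i) (V j) → InPairs ps i j
    InPairs⁻ ps (inj₁ h) with (a , b) , ab∈ , e ← ∈-map⁻ V² h
      with refl ← V-injective _ a (cong proj₁ e) | refl ← V-injective _ b (cong proj₂ e) = inj₁ ab∈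
    InPairs⁻ ps (inj₂ h) with (a , b) , ab∈ , e ← ∈-map⁻ V² h
      with refl ← V-injective _ a (cong proj₁ e) | refl ← V-injective _ b (cong proj₂ e) = inj₂ ab∈

    InPairs⁺ : ∀ ps {i j} → InPairs ps i j → InPairs (map V² ps) (V i) (V j)
    InPairs⁺ ps (inj₁ h) = inj₁ (∈-map⁺ V² h)
    InPairs⁺ ps (inj₂ h) = inj₂ (∈-map⁺ V² h)

    scaffoldIs : ScaffoldIs G Π (map V² singles) (map V² doubles)
    scaffoldIs u w u≢w with i , refl ← V-surjective u | j , refl ← V-surjective w =
      (λ h → subst (Mult G Π _ _) (singles-count i j (InPairs⁻ singles h)) m) ,
      (λ h → subst (Mult G Π _ _) (doubles-count i j (InPairs⁻ doubles h)) m) ,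
      λ ¬s ¬d → subst (Mult G Π _ _) (none ¬s ¬d (others-count i j)) m
      where
      m = mult i j λ e → u≢w (cong V e)
      none : ¬ InPairs (map V² singles) (V i) (V j) → ¬ InPairs (map V² doubles) (V i) (V j) →
        (i ≡ j ⊎ InPairs singles i j ⊎ InPairs doubles i j) ⊎ length (mids i j) ≡ 0 → length (mids i j) ≡ 0
      none ¬s ¬d (inj₁ (inj₁ e)) = contradiction (cong V e) u≢w
      none ¬s ¬d (inj₁ (inj₂ (inj₁ s))) = contradiction (InPairs⁺ singles s) ¬s
      none ¬s ¬d (inj₁ (inj₂ (inj₂ d))) = contradiction (InPairs⁺ doubles d) ¬d
      none ¬s ¬d (inj₂ e) = e

-- The butterfly

map-Unique-injective : ∀ {X Y : Set} (f : X → Y) {xs i j} → Unique (map f xs) →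
  i ∈ xs → j ∈ xs → f i ≡ f j → i ≡ j
map-Unique-injective f (_ ∷ _) (here refl) (here refl) _ = refl
map-Unique-injective f (f∉ ∷ _) (here refl) (there j∈) e = contradiction e (All.lookup f∉ (∈-map⁺ f j∈))
map-Unique-injective f (f∉ ∷ _) (there i∈) (here refl) e = contradiction (sym e) (All.lookup f∉ (∈-map⁺ f i∈))
map-Unique-injective f (_ ∷ u) (there i∈) (there j∈) e = map-Unique-injective f u i∈ j∈ e

module Butterfly {n} (G : Graph n) (cubic : Cubic G) (Π : FaceSystem n) (poly : IsPolyhedral G Π)
  (ρ₀ : ℕ → Fin n) (distinct₀ : Unique (map ρ₀ (real initial)))
  (rows₀ : All (λ (v , a , b , c) → CubicGraph.Nbrs G cubic (ρ₀ v) (ρ₀ a) (ρ₀ b) (ρ₀ c)) (rows initial))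
  (¬scaffold : ¬ Scaffold G Π (ρ₀ 1) (ρ₀ 4))
  (¬solvable : ¬ ForkSolvable G Π (ρ₀ 2) (ρ₀ 3) (ρ₀ 4) (ρ₀ 5) (ρ₀ 6)) where

  open CubicGraph G cubic
  open Counting G cubic

  ρ₀-injective : ∀ {i j} → i ∈ real initial → j ∈ real initial → ρ₀ i ≡ ρ₀ j → i ≡ j
  ρ₀-injective = map-Unique-injective ρ₀ distinct₀

  ρ₀-apart : ∀ i j {_ : True (i ∈ᴸ? real initial)} {_ : True (j ∈ᴸ? real initial)} {_ : False (i ℕ.≟ j)} →
    ρ₀ i ≢ ρ₀ j
  ρ₀-apart i j {i∈} {j∈} {i≢j} e = toWitnessFalse i≢j (ρ₀-injective (toWitness i∈) (toWitness j∈) e)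

  N-t2 : Nbrs (ρ₀ 3) (ρ₀ 2) (ρ₀ 4) (ρ₀ 19)
  N-t2 = All.lookup rows₀ (there (there (there (here refl))))

  N-t3 : Nbrs (ρ₀ 4) (ρ₀ 3) (ρ₀ 5) (ρ₀ 6)
  N-t3 = All.lookup rows₀ (there (there (there (there (here refl)))))

  record Turning (t : Fin n) : Set where
    field
      Π′ : FaceSystem n
      poly′ : IsPolyhedral G Π′
      same′ : SameExtended G Π Π′
      facial′ : FacialSub Π′ (ρ₀ 2 ∷ ρ₀ 3 ∷ ρ₀ 4 ∷ t ∷ [])
  open Turning

  -- The face at the corner `t1 t2 t3` must leave `t3` towards `t4` or `t4'`. If no embedding took
  -- one of these turns, all would take the other and the fork would be solved.
  fork-turns : ∀ Π′ → IsPolyhedral G Π′ →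
    FacialSub Π′ (ρ₀ 2 ∷ ρ₀ 3 ∷ ρ₀ 4 ∷ ρ₀ 5 ∷ []) ⊎ FacialSub Π′ (ρ₀ 2 ∷ ρ₀ 3 ∷ ρ₀ 4 ∷ ρ₀ 6 ∷ [])
  fork-turns Π′ poly′ with Polyhedral.F-edge Π′ poly′ (swap₁₂ N-t2) N-t3
  ... | inj₁ (e , _) = inj₁ (proj₂ (Polyhedral.F⇒FacialPath Π′ poly′ (ρ₀-apart 2 5) N-t2 N-t3 e))
  ... | inj₂ (e , _) = inj₂ (proj₂ (Polyhedral.F⇒FacialPath Π′ poly′ (ρ₀-apart 2 6) N-t2 (swap₂₃ N-t3) e))

  ¬¬turning-t4 : ¬ ¬ Turning (ρ₀ 5)
  ¬¬turning-t4 none = ¬solvable (inj₂ λ Π′ poly′ same′ → otherwise (fork-turns Π′ poly′) λ h →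
    none record { poly′ = poly′ ; same′ = same′ ; facial′ = h })
    where
    otherwise : ∀ {X Y : Set} → X ⊎ Y → ¬ X → Y
    otherwise (inj₁ x) ¬x = contradiction x ¬x
    otherwise (inj₂ y) _ = y

  ¬¬turning-t4′ : ¬ ¬ Turning (ρ₀ 6)
  ¬¬turning-t4′ none = ¬solvable (inj₁ λ Π′ poly′ same′ → otherwise (fork-turns Π′ poly′) λ h →
    none record { poly′ = poly′ ; same′ = same′ ; facial′ = h })
    where
    otherwise : ∀ {X Y : Set} → X ⊎ Y → ¬ Y → X
    otherwise (inj₁ x) _ = x
    otherwise (inj₂ y) ¬y = contradiction y ¬y

  V₀ : Vertex → Fin n
  V₀ i = ρ₀ (lookup franklinLabels i)

  module Solve (TA : Turning (ρ₀ 5)) (TB : Turning (ρ₀ 6)) where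

    S : Emb → FaceSystem n
    S A = Π′ TA
    S B = Π′ TB

    polyS : ∀ e → IsPolyhedral G (S e)
    polyS A = poly′ TA
    polyS B = poly′ TB

    sameΠ : ∀ e → SameExtended G Π (S e)
    sameΠ A = same′ TA
    sameΠ B = same′ TB

    sameS : ∀ e → SameExtended G (S e) (S (other e))
    sameS e = SameExtended-trans G {S e} {Π} {S (other e)} (SameExtended-sym G {Π} {S e} (sameΠ e)) (sameΠ (other e))

    -- The hypothesis speaks of `Π` alone. Equal multiplicities carry it over: one path in `S e`
    -- against an empty list of candidates in `Π`.
    unscaffolded : ∀ e b c → ¬ FacialPath G (S e) (ρ₀ 1) b c (ρ₀ 4)
    unscaffolded e b c h with () ← facial-count-≤ {S e} {Π} (polyS e) (SameExtended-sym G {Π} {S e} (sameΠ e)) (ρ₀-apart 1 4)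
      {L = (b , c) ∷ []} {M = []} ([] ∷ []) (λ { (here refl) → h }) (λ {p} h′ → ⊥-elim (¬scaffold (ρ₀-apart 1 4 , _ , _ , h′)))

    open Search G cubic S polyS sameS ρ₀ franklin unscaffolded

    model : Model ρ₀ initial
    model = record
      { base = λ _ _ → refl
      ; rows✓ = rows₀
      ; real✓ = ρ₀-injective
      ; half✓ = []
      ; eqs✓ = λ
        { A → Polyhedral.FacialSub⇒F (S A) (polyS A) N-t2 N-t3 (facial′ TA) ∷ []
        ; B → Polyhedral.FacialSub⇒F (S B) (polyS B) N-t2 (swap₂₃ N-t3) (facial′ TB) ∷ [] } }

    goal : Goal
    -- The type checker evaluates the whole certificate here: `tt` is accepted only if the result is
    -- a `just`.
    goal = to-witness-T (check certificate initial) tt model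

    embedding : FranklinEmbedding G cubic Π V₀
    embedding = record
      { poly′ = poly′ TA ; same′ = same′ TA
      ; V-injective = Goal.V-injective goal
      ; V-nbrs = Goal.V-nbrs goal
      ; V-facial = Goal.V-facial goal }

  ¬¬embedding : ¬ ¬ FranklinEmbedding G cubic Π V₀
  ¬¬embedding none = ¬¬turning-t4 λ TA → ¬¬turning-t4′ λ TB → none (Solve.embedding TA TB)

V² : ∀ {n} → (ℕ → Fin n) → Vertex × Vertex → Fin n × Fin n
V² ρ (i , j) = ρ (lookup franklinLabels i) , ρ (lookup franklinLabels j)

module Conclusion {n} (G : Graph n) (Π : FaceSystem n) (cubic : Cubic G) (poly : IsPolyhedral G Π)
  (t0 t0' t1 t2 t3 t4 t4' t5 t5' x0 x0' x2 x4 x4' x5 x5' : Fin n) where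

  open CubicGraph G cubic

  labelling : ℕ → Fin n
  labelling = at   -- the fillers t0 are never looked up
    (t0 ∷ t0' ∷ t1 ∷ t2 ∷ t3 ∷ t4 ∷ t4' ∷ t5 ∷ t5' ∷ t0 ∷ t0 ∷ t0 ∷ t0 ∷ t0 ∷ t0 ∷ t0 ∷
     x0 ∷ x0' ∷ t0 ∷ x2 ∷ t0 ∷ x4 ∷ x4' ∷ x5 ∷ x5' ∷ [])
    where
    at : List (Fin n) → ℕ → Fin n
    at [] _ = t0
    at (y ∷ _) zero = y
    at (_ ∷ ys) (suc i) = at ys i

  conclusion : Unique (t0 ∷ t0' ∷ t1 ∷ t2 ∷ t3 ∷ t4 ∷ t4' ∷ t5 ∷ t5' ∷ []) →
    Nbrs t0 t1 t5 x0 → Nbrs t0' t1 t5' x0' → Nbrs t1 t0 t0' t2 → Nbrs t2 t1 t3 x2 → Nbrs t3 t2 t4 t4' →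
    Nbrs t4 t3 t5 x4 → Nbrs t4' t3 t5' x4' → Nbrs t5 t4 t0 x5 → Nbrs t5' t4' t0' x5' →
    ¬ Scaffold G Π t0' t3 → ¬ ForkSolvable G Π t1 t2 t3 t4 t4' →
    IsoToFranklin G × ScaffoldIs G Π (map (V² labelling) singles) (map (V² labelling) doubles)
  conclusion uniq N0 N0' N1 N2 N3 N4 N4' N5 N5' ¬scaffold ¬solvable = isoToFranklin , scaffoldIs
    where
    open Butterfly G cubic Π poly labelling uniq (N0 ∷ N0' ∷ N1 ∷ N2 ∷ N3 ∷ N4 ∷ N4' ∷ N5 ∷ N5' ∷ []) ¬scaffold ¬solvable
    open FranklinConclusion G cubic (proj₁ (proj₁ poly)) Π poly V₀ ¬¬embedding

-- From the two 6-cycles to the neighbourhoods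

cycle-adjacent : ∀ {n} (G : Graph n) (c : List (Fin n)) → IsCycle G c →
  ∀ {u v rest} i → rot i c ≡ u ∷ v ∷ rest → Adj G u v
cycle-adjacent G c (_ , _ , h) i e = h _ _ (i , _ , e)

theorem17 : ∀ {n} (G : Graph n) (Π : FaceSystem n) →
    Cubic G → IsPolyhedral G Π →
    ∀ (t0 t0' t1 t2 t3 t4 t4' t5 t5' : Fin n) →
    IsButterflyTwo G Π t0 t0' t1 t2 t3 t4 t4' t5 t5' →
    ¬ Scaffold G Π t0' t3 →
    ¬ ForkSolvable G Π t1 t2 t3 t4 t4' →
    IsoToFranklin G ×
    (∀ (x0 x2 x5 : Fin n) →
    Adj G t0 x0 → ¬ x0 ∈ (t0 ∷ t1 ∷ t2 ∷ t3 ∷ t4 ∷ t5 ∷ []) →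
    Adj G t2 x2 → ¬ x2 ∈ (t0 ∷ t1 ∷ t2 ∷ t3 ∷ t4 ∷ t5 ∷ []) →
    Adj G t5 x5 → ¬ x5 ∈ (t0 ∷ t1 ∷ t2 ∷ t3 ∷ t4 ∷ t5 ∷ []) →
    ScaffoldIs G Π
    ((t0 , t5) ∷ (t5 , x5) ∷ (x5 , x0) ∷ (x0 , t0) ∷
    (t1 , t2) ∷ (t2 , x2) ∷ (x2 , t0') ∷ (t0' , t1) ∷
    (t3 , t4') ∷ (t4' , t5') ∷ (t5' , t4) ∷ (t4 , t3) ∷ [])
    ((t0 , t3) ∷ (x0 , t2) ∷ (t1 , t4') ∷ (t0' , t5) ∷
    (t4 , x2) ∷ (x5 , t5') ∷ (t0 , t5') ∷ (t1 , t4) ∷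
    (t2 , t5) ∷ (t3 , x5) ∷ (t4' , x2) ∷ (x0 , t0') ∷ []))
theorem17 {n} G Π cubic poly t0 t0' t1 t2 t3 t4 t4' t5 t5'
  (uniq@((t0≢t0' ∷ t0≢t1 ∷ t0≢t2 ∷ t0≢t3 ∷ t0≢t4 ∷ _) ∷ (t0'≢t1 ∷ t0'≢t2 ∷ _ ∷ _ ∷ t0'≢t4' ∷ _) ∷
         (_ ∷ t1≢t3 ∷ _ ∷ _ ∷ t1≢t5 ∷ t1≢t5' ∷ []) ∷ (_ ∷ t2≢t4 ∷ t2≢t4' ∷ _) ∷
         (_ ∷ _ ∷ t3≢t5 ∷ t3≢t5' ∷ []) ∷ (t4≢t4' ∷ _) ∷ _) , C , C' , _) ¬scaffold ¬solvable =
  proj₁ result , scaffolds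
  where
  open CubicGraph G cubic
  -- Rotating by `i` brings the edge number `i`, counted from zero, to the front; `edgeC 5` is the
  -- closing edge from `t5` to `t0`.
  edgeC : ∀ {u v rest} i → rot i (t0 ∷ t1 ∷ t2 ∷ t3 ∷ t4 ∷ t5 ∷ []) ≡ u ∷ v ∷ rest → Adj G u v
  edgeC = cycle-adjacent G _ C
  edgeC' : ∀ {u v rest} i → rot i (t0' ∷ t1 ∷ t2 ∷ t3 ∷ t4' ∷ t5' ∷ []) ≡ u ∷ v ∷ rest → Adj G u v
  edgeC' = cycle-adjacent G _ C'
  flip : ∀ {u v} → Adj G u v → Adj G v u
  flip = Adj-sym G
  N0 : ∃ (Nbrs t0 t1 t5)
  N0 = third (edgeC 0 refl) (flip (edgeC 5 refl)) t1≢t5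
  N0' : ∃ (Nbrs t0' t1 t5')
  N0' = third (edgeC' 0 refl) (flip (edgeC' 5 refl)) t1≢t5'
  N1 : Nbrs t1 t0 t0' t2
  N1 = nbrs-of-three (flip (edgeC 0 refl)) (flip (edgeC' 0 refl)) (edgeC 1 refl) t0≢t0' t0≢t2 t0'≢t2
  N2 : ∃ (Nbrs t2 t1 t3)
  N2 = third (flip (edgeC 1 refl)) (edgeC 2 refl) t1≢t3
  N3 : Nbrs t3 t2 t4 t4'
  N3 = nbrs-of-three (flip (edgeC 2 refl)) (edgeC 3 refl) (edgeC' 3 refl) t2≢t4 t2≢t4' t4≢t4'
  N4 : ∃ (Nbrs t4 t3 t5)
  N4 = third (flip (edgeC 3 refl)) (edgeC 4 refl) t3≢t5
  N4' : ∃ (Nbrs t4' t3 t5')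
  N4' = third (flip (edgeC' 3 refl)) (edgeC' 4 refl) t3≢t5'
  N5 : ∃ (Nbrs t5 t4 t0)
  N5 = third (flip (edgeC 4 refl)) (edgeC 5 refl) (≢-sym t0≢t4)
  N5' : ∃ (Nbrs t5' t4' t0')
  N5' = third (flip (edgeC' 4 refl)) (edgeC' 5 refl) (≢-sym t0'≢t4')
  result = Conclusion.conclusion G Π cubic poly t0 t0' t1 t2 t3 t4 t4' t5 t5'
    (proj₁ N0) (proj₁ N0') (proj₁ N2) (proj₁ N4) (proj₁ N4') (proj₁ N5) (proj₁ N5') uniq
    (proj₂ N0) (proj₂ N0') N1 (proj₂ N2) N3 (proj₂ N4) (proj₂ N4') (proj₂ N5) (proj₂ N5') ¬scaffold ¬solvable
  -- This identifies the `x0`, `x2`, `x5` of the statement with the vertices that `third` picked: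
  -- the other two neighbours lie on the cycle.
  third-outside : ∀ {v a b c x l} → Nbrs v a b c → Adj G v x → x ∉ l → a ∈ l → b ∈ l → x ≡ c
  third-outside N vx x∉ a∈ b∈ with complete N _ vx
  ... | inj₁ refl = contradiction a∈ x∉
  ... | inj₂ (inj₁ refl) = contradiction b∈ x∉
  ... | inj₂ (inj₂ e) = e
  scaffolds : ∀ (x0 x2 x5 : Fin n) → _
  scaffolds x0 x2 x5 t0x0 x0∉ t2x2 x2∉ t5x5 x5∉
    with refl ← third-outside (proj₂ N0) t0x0 x0∉ (there (here refl)) (there (there (there (there (there (here refl))))))
       | refl ← third-outside (proj₂ N2) t2x2 x2∉ (there (here refl)) (there (there (there (here refl))))
       | refl ← third-outside (proj₂ N5) t5x5 x5∉ (there (there (there (there (here refl))))) (here refl)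
    = proj₂ result
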